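{- Consider the Online Interval Selection problem on inputs that are simple chains, in the random order model. The basic greedy algorithm without revoking has competitive ratio exactly $1-\frac{1}{e^2}$ on this class of inputs. That is, $1-e^{ -2}$ is the largest real number $\rho$ for which there exists a constant $b$ such that, for every simple chain $I$ of $n\ge 1$ intervals, $\mathbb{E}_\sigma\left[\mathrm{ALG}(I,\sigma)\right]\ \ge\ \rho\cdot \mathrm{OPT}(I)-b$, where $\mathrm{ALG}(I,\sigma)$ is the number of intervals selected by the basic greedy algorithm when the intervals of $I$ arrive in the order $\sigma$, and $\sigma$ is a uniformly random permutation.
   Context: A simple chain of size $n$ is a set of $n$ unit-length intervals $I_1,\dots,I_n$ on the real line, numbered from left to right, such that $I_i$ and $I_j$ ($i\neq j$) overlap if and only if $|i-j|=1$ (the intersection graph is a path on $n$ vertices in this order). Online Interval Selection (unweighted): intervals arrive one by one, and the algorithm accepts or rejects each interval on arrival so that the selected intervals are pairwise non-overlapping. The value of the algorithm is the number of selected intervals. $\mathrm{OPT}(I)$ is the maximum size of a set of pairwise non-overlapping intervals of $I$ (equal to $\lceil n/2\rceil$ for a simple chain of size $n$). Random order model: the set of intervals is fixed by an adversary and then presented in a uniformly random order; the algorithm's performance is its expected value over this order. Basic greedy algorithm: accept an arriving interval if and only if it does not overlap any previously selected interval; never revoke. -}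

module Defs where

open import Data.Bool.Base using (if_then_else_)
open import Data.Fin.Base as Fin using (Fin; toℕ)
import Data.Fin.Properties as Fin
open import Data.Fin.Subset using (Subset; inside; outside; _∈_; ∣_∣)
open import Data.Fin.Subset.Properties using (_∈?_)
open import Data.Integer.Base as ℤ using (+_; -[1+_])
import Data.Integer.Properties as ℤ
open import Data.List.Base
  using (List; []; _∷_; [_]; _++_; map; concatMap; filter; foldl; length; allFin)
open import Data.List.Extrema.Nat using (max)
open import Data.List.Relation.Unary.Any using (any?)
open import Data.Nat.ListAction using (sum)
open import Data.Nat.Base as ℕ using (ℕ; zero; suc; _!)
import Data.Nat.Properties as ℕ
open import Data.Product.Base using (∃-syntax; _×_; _,_; proj₁; proj₂)
open import Data.Rational.Base as ℚ
  using (ℚ; 0ℚ; 1ℚ; ½; _/_; _+_; _*_; _-_; -_; _≤_; _<_; Positive; NonNegative)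
import Data.Rational.Properties as ℚ
open import Data.Rational.Unnormalised.Base as ℚᵘ using (mkℚᵘ; *≡*; *≤*)
import Data.Rational.Unnormalised.Properties as ℚᵘ
open import Data.Rational.Solver using (module +-*-Solver)
open import Data.Vec.Base using (_∷_; [])
open import Function.Bundles using (_⇔_; Equivalence)
open import Relation.Binary.PropositionalEquality
  using (_≡_; _≢_; refl; sym; trans; cong; cong₂; subst; subst₂; module ≡-Reasoning)
open import Relation.Nullary using (Dec; yes; no; ¬_; does)
open import Relation.Nullary.Decidable using (map′; _→-dec_; ¬?)

open import Algebra.Definitions.RawSemiring ℚ.+-*-rawSemiring using (_^_)

IsCauchy : (ℕ → ℚ) → Set
IsCauchy x = ∀ ε → 0ℚ < ε →
  ∃[ N ] (∀ m n → N ℕ.≤ m → N ℕ.≤ n → ℚ.∣ x m - x n ∣ ≤ ε)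

-- Real numbers are Cauchy sequences of rationals; their equality is _≃ᵣ_.
record ℝ : Set where
  constructor mkℝ
  field
    seq      : ℕ → ℚ
    isCauchy : IsCauchy seq

open ℝ public

infix 4 _≤ᵣ_ _<ᵣ_ _≃ᵣ_

_≤ᵣ_ : ℝ → ℝ → Set
x ≤ᵣ y = ∀ ε → 0ℚ < ε → ∃[ N ] (∀ n → N ℕ.≤ n → seq x n ≤ seq y n + ε)

_<ᵣ_ : ℝ → ℝ → Set
x <ᵣ y = ∃[ ε ] (0ℚ < ε × ∃[ N ] (∀ n → N ℕ.≤ n → seq x n + ε ≤ seq y n))

_≃ᵣ_ : ℝ → ℝ → Set
x ≃ᵣ y = x ≤ᵣ y × y ≤ᵣ x

private
  half : ℚ → ℚ
  half ε = ½ * ε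

  half-pos : ∀ {ε} → 0ℚ < ε → 0ℚ < half ε
  half-pos {ε} 0<ε = subst (_< half ε) (ℚ.*-zeroʳ ½) (ℚ.*-monoʳ-<-pos ½ 0<ε)

  half+half : ∀ ε → half ε + half ε ≡ ε
  half+half = solve 1 (λ e → con ½ :* e :+ con ½ :* e := e) refl
    where open +-*-Solver

  p-p≡0 : ∀ p → p - p ≡ 0ℚ
  p-p≡0 = ℚ.+-inverseʳ

  ∣p-q∣≡∣q-p∣ : ∀ p q → ℚ.∣ p - q ∣ ≡ ℚ.∣ q - p ∣
  ∣p-q∣≡∣q-p∣ p q = trans (sym (ℚ.∣-p∣≡∣p∣ (p - q))) (cong ℚ.∣_∣ (lemma p q))
    where
    open +-*-Solver
    lemma : ∀ p q → - (p - q) ≡ q - p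
    lemma = solve 2 (λ p q → :- (p :- q) := q :- p) refl

  ∣p-r∣≤ : ∀ p q r → ℚ.∣ p - r ∣ ≤ ℚ.∣ p - q ∣ + ℚ.∣ q - r ∣
  ∣p-r∣≤ p q r = subst (λ h → ℚ.∣ h ∣ ≤ ℚ.∣ p - q ∣ + ℚ.∣ q - r ∣) (lemma p q r)
    (ℚ.∣p+q∣≤∣p∣+∣q∣ (p - q) (q - r))
    where
    open +-*-Solver
    lemma : ∀ p q r → (p - q) + (q - r) ≡ p - r
    lemma = solve 3 (λ p q r → (p :- q) :+ (q :- r) := p :- r) refl

  p≤p+ε : ∀ p {ε} → 0ℚ ≤ ε → p ≤ p + ε
  p≤p+ε p {ε} 0≤ε = subst (_≤ p + ε) (ℚ.+-identityʳ p) (ℚ.+-monoʳ-≤ p 0≤ε)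

  -- It is enough to compare later terms with one fixed term.
  mkCauchy : ∀ (x : ℕ → ℚ) →
    (∀ ε → 0ℚ < ε → ∃[ N ] (∀ m → N ℕ.≤ m → ℚ.∣ x m - x N ∣ ≤ ε)) → IsCauchy x
  mkCauchy x f ε 0<ε with f (half ε) (half-pos 0<ε)
  ... | N , p = N , λ m n N≤m N≤n → begin
    ℚ.∣ x m - x n ∣                      ≤⟨ ∣p-r∣≤ (x m) (x N) (x n) ⟩
    ℚ.∣ x m - x N ∣ + ℚ.∣ x N - x n ∣    ≡⟨ cong (λ h → ℚ.∣ x m - x N ∣ + h) (∣p-q∣≡∣q-p∣ (x N) (x n)) ⟩
    ℚ.∣ x m - x N ∣ + ℚ.∣ x n - x N ∣    ≤⟨ ℚ.+-mono-≤ (p m N≤m) (p n N≤n) ⟩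
    half ε + half ε                      ≡⟨ half+half ε ⟩
    ε                                    ∎
    where open ℚ.≤-Reasoning

  toNonNeg : ∀ {p} → 0ℚ ≤ p → NonNegative p
  toNonNeg = ℚ.nonNegative

  *-mono-≤ : ∀ {p q r s} → 0ℚ ≤ r → 0ℚ ≤ q → p ≤ q → r ≤ s → p * r ≤ q * s
  *-mono-≤ {p} {q} {r} {s} 0≤r 0≤q p≤q r≤s = ℚ.≤-trans
    (ℚ.*-monoʳ-≤-nonNeg r {{toNonNeg 0≤r}} p≤q)
    (ℚ.*-monoˡ-≤-nonNeg q {{toNonNeg 0≤q}} r≤s)

fromℚ : ℚ → ℝ
fromℚ q = mkℝ (λ _ → q) λ ε 0<ε → 0 , λ _ _ _ _ →
  subst (_≤ ε) (sym (cong ℚ.∣_∣ (p-p≡0 q))) (ℚ.<⇒≤ 0<ε)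

fromℕ : ℕ → ℝ
fromℕ n = fromℚ (+ n / 1)

1ᵣ : ℝ
1ᵣ = fromℚ 1ℚ

infixl 6 _+ᵣ_ _-ᵣ_
infixl 7 _*ᵣ_
infix  8 -ᵣ_

_+ᵣ_ : ℝ → ℝ → ℝ
seq      (x +ᵣ y) n = seq x n + seq y n
isCauchy (x +ᵣ y) ε 0<ε
  with isCauchy x (half ε) (half-pos 0<ε) | isCauchy y (half ε) (half-pos 0<ε)
... | N₁ , p | N₂ , q = N₁ ℕ.⊔ N₂ , λ m n N≤m N≤n → begin
  ℚ.∣ (seq x m + seq y m) - (seq x n + seq y n) ∣
    ≡⟨ cong ℚ.∣_∣ (lemma (seq x m) (seq y m) (seq x n) (seq y n)) ⟩
  ℚ.∣ (seq x m - seq x n) + (seq y m - seq y n) ∣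
    ≤⟨ ℚ.∣p+q∣≤∣p∣+∣q∣ (seq x m - seq x n) (seq y m - seq y n) ⟩
  ℚ.∣ seq x m - seq x n ∣ + ℚ.∣ seq y m - seq y n ∣
    ≤⟨ ℚ.+-mono-≤ (p m n (ℕ.m⊔n≤o⇒m≤o N₁ N₂ N≤m) (ℕ.m⊔n≤o⇒m≤o N₁ N₂ N≤n))
                  (q m n (ℕ.m⊔n≤o⇒n≤o N₁ N₂ N≤m) (ℕ.m⊔n≤o⇒n≤o N₁ N₂ N≤n)) ⟩
  half ε + half ε
    ≡⟨ half+half ε ⟩
  ε ∎
  where
  open ℚ.≤-Reasoning
  lemma : ∀ a b c d → (a + b) - (c + d) ≡ (a - c) + (b - d)
  lemma = solve 4 (λ a b c d → (a :+ b) :- (c :+ d) := (a :- c) :+ (b :- d)) refl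
    where open +-*-Solver

-ᵣ_ : ℝ → ℝ
seq      (-ᵣ x) n = - seq x n
isCauchy (-ᵣ x) ε 0<ε with isCauchy x ε 0<ε
... | N , p = N , λ m n N≤m N≤n →
  subst (_≤ ε) (sym (trans (cong ℚ.∣_∣ (lemma (seq x m) (seq x n)))
                           (ℚ.∣-p∣≡∣p∣ (seq x m - seq x n)))) (p m n N≤m N≤n)
  where
  lemma : ∀ a b → (- a) - (- b) ≡ - (a - b)
  lemma = solve 2 (λ a b → (:- a) :- (:- b) := :- (a :- b)) refl
    where open +-*-Solver

_-ᵣ_ : ℝ → ℝ → ℝ
x -ᵣ y = x +ᵣ (-ᵣ y)

private
  eventuallyBounded : (x : ℝ) →
    ∃[ B ] (0ℚ < B × ∃[ N ] (∀ n → N ℕ.≤ n → ℚ.∣ seq x n ∣ ≤ B))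
  eventuallyBounded x with isCauchy x 1ℚ (ℚ.positive⁻¹ 1ℚ)
  ... | N , p = ℚ.∣ seq x N ∣ + 1ℚ , 0<B , N , bound
    where
    open ℚ.≤-Reasoning
    0<B : 0ℚ < ℚ.∣ seq x N ∣ + 1ℚ
    0<B = begin-strict
      0ℚ                    ≡⟨ ℚ.+-identityʳ 0ℚ ⟨
      0ℚ + 0ℚ               <⟨ ℚ.+-mono-≤-< (ℚ.0≤∣p∣ (seq x N)) (ℚ.positive⁻¹ 1ℚ) ⟩
      ℚ.∣ seq x N ∣ + 1ℚ    ∎
    lemma : ∀ a b → a ≡ b + (a - b)
    lemma = solve 2 (λ a b → a := b :+ (a :- b)) refl
      where open +-*-Solver
    bound : ∀ n → N ℕ.≤ n → ℚ.∣ seq x n ∣ ≤ ℚ.∣ seq x N ∣ + 1ℚ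
    bound n N≤n = begin
      ℚ.∣ seq x n ∣                                  ≡⟨ cong ℚ.∣_∣ (lemma (seq x n) (seq x N)) ⟩
      ℚ.∣ seq x N + (seq x n - seq x N) ∣            ≤⟨ ℚ.∣p+q∣≤∣p∣+∣q∣ (seq x N) (seq x n - seq x N) ⟩
      ℚ.∣ seq x N ∣ + ℚ.∣ seq x n - seq x N ∣        ≤⟨ ℚ.+-monoʳ-≤ ℚ.∣ seq x N ∣ (p n N N≤n ℕ.≤-refl) ⟩
      ℚ.∣ seq x N ∣ + 1ℚ                             ∎

  divide : ∀ {B ε} → 0ℚ < B → 0ℚ < ε → ∃[ δ ] (0ℚ < δ × B * δ ≡ ε)
  divide {B} {ε} 0<B 0<ε = (1/B * ε) , 0<δ , eq
    where
    instance
      B-pos : Positive B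
      B-pos = ℚ.positive 0<B
      B≢0 : ℚ.NonZero B
      B≢0 = ℚ.pos⇒nonZero B
    1/B : ℚ
    1/B = ℚ.1/ B
    0<δ : 0ℚ < 1/B * ε
    0<δ = subst (_< 1/B * ε) (ℚ.*-zeroʳ 1/B) (ℚ.*-monoʳ-<-pos 1/B {{ℚ.1/pos⇒pos B}} 0<ε)
    eq : B * (1/B * ε) ≡ ε
    eq = trans (sym (ℚ.*-assoc B 1/B ε))
               (trans (cong (_* ε) (ℚ.*-inverseʳ B)) (ℚ.*-identityˡ ε))

  *-close : ∀ {B C γ δ ε} a b c d → 0ℚ < B → 0ℚ < C →
            B * δ ≡ half ε → C * γ ≡ half ε →
            ℚ.∣ a ∣ ≤ B → ℚ.∣ d ∣ ≤ C → ℚ.∣ a - c ∣ ≤ γ → ℚ.∣ b - d ∣ ≤ δ →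
            ℚ.∣ a * b - c * d ∣ ≤ ε
  *-close {B} {C} {γ} {δ} {ε} a b c d 0<B 0<C Bδ≡ Cγ≡ ∣a∣≤ ∣d∣≤ ∣a-c∣≤ ∣b-d∣≤ = begin
    ℚ.∣ a * b - c * d ∣                     ≡⟨ cong ℚ.∣_∣ (lemma a b c d) ⟩
    ℚ.∣ a * (b - d) + d * (a - c) ∣         ≤⟨ ℚ.∣p+q∣≤∣p∣+∣q∣ (a * (b - d)) (d * (a - c)) ⟩
    ℚ.∣ a * (b - d) ∣ + ℚ.∣ d * (a - c) ∣   ≡⟨ cong₂ _+_ (ℚ.∣p*q∣≡∣p∣*∣q∣ a (b - d)) (ℚ.∣p*q∣≡∣p∣*∣q∣ d (a - c)) ⟩
    ℚ.∣ a ∣ * ℚ.∣ b - d ∣ + ℚ.∣ d ∣ * ℚ.∣ a - c ∣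
      ≤⟨ ℚ.+-mono-≤ (*-mono-≤ (ℚ.0≤∣p∣ (b - d)) (ℚ.<⇒≤ 0<B) ∣a∣≤ ∣b-d∣≤)
                    (*-mono-≤ (ℚ.0≤∣p∣ (a - c)) (ℚ.<⇒≤ 0<C) ∣d∣≤ ∣a-c∣≤) ⟩
    B * δ + C * γ                           ≡⟨ cong₂ _+_ Bδ≡ Cγ≡ ⟩
    half ε + half ε                         ≡⟨ half+half ε ⟩
    ε                                       ∎
    where
    open ℚ.≤-Reasoning
    lemma : ∀ a b c d → a * b - c * d ≡ a * (b - d) + d * (a - c)
    lemma = solve 4 (λ a b c d → a :* b :- c :* d := a :* (b :- d) :+ d :* (a :- c)) refl
      where open +-*-Solver

_*ᵣ_ : ℝ → ℝ → ℝ
seq      (x *ᵣ y) n = seq x n * seq y n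
isCauchy (x *ᵣ y) ε 0<ε =
  let B , 0<B , M₁ , ∣x∣≤B = eventuallyBounded x
      C , 0<C , M₂ , ∣y∣≤C = eventuallyBounded y
      δ , 0<δ , Bδ≡ = divide 0<B (half-pos 0<ε)
      γ , 0<γ , Cγ≡ = divide 0<C (half-pos 0<ε)
      N₁ , p = isCauchy x γ 0<γ
      N₂ , q = isCauchy y δ 0<δ
      M₁₂ = M₁ ℕ.⊔ M₂
      N₁₂ = N₁ ℕ.⊔ N₂
      M₁≤ : ∀ k → M₁₂ ℕ.⊔ N₁₂ ℕ.≤ k → M₁ ℕ.≤ k
      M₁≤ k k≥ = ℕ.m⊔n≤o⇒m≤o M₁ M₂ (ℕ.m⊔n≤o⇒m≤o M₁₂ N₁₂ k≥)
      M₂≤ : ∀ k → M₁₂ ℕ.⊔ N₁₂ ℕ.≤ k → M₂ ℕ.≤ k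
      M₂≤ k k≥ = ℕ.m⊔n≤o⇒n≤o M₁ M₂ (ℕ.m⊔n≤o⇒m≤o M₁₂ N₁₂ k≥)
      N₁≤ : ∀ k → M₁₂ ℕ.⊔ N₁₂ ℕ.≤ k → N₁ ℕ.≤ k
      N₁≤ k k≥ = ℕ.m⊔n≤o⇒m≤o N₁ N₂ (ℕ.m⊔n≤o⇒n≤o M₁₂ N₁₂ k≥)
      N₂≤ : ∀ k → M₁₂ ℕ.⊔ N₁₂ ℕ.≤ k → N₂ ℕ.≤ k
      N₂≤ k k≥ = ℕ.m⊔n≤o⇒n≤o N₁ N₂ (ℕ.m⊔n≤o⇒n≤o M₁₂ N₁₂ k≥)
  in M₁₂ ℕ.⊔ N₁₂ , λ m n m≥ n≥ →
     *-close (seq x m) (seq y m) (seq x n) (seq y n) 0<B 0<C Bδ≡ Cγ≡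
       (∣x∣≤B m (M₁≤ m m≥)) (∣y∣≤C n (M₂≤ n n≥))
       (p m n (N₁≤ m m≥) (N₁≤ n n≥)) (q m n (N₂≤ m m≥) (N₂≤ n n≥))

expTerm : ℚ → ℕ → ℚ
expTerm q k = q ^ k * (_/_ (+ 1) (k !) {{k ℕ.!≢0}})

expSum : ℚ → ℕ → ℚ
expSum q zero    = 0ℚ
expSum q (suc n) = expSum q n + expTerm q n

private
  recip-* : ∀ m n .{{_ : ℕ.NonZero m}} .{{_ : ℕ.NonZero n}} .{{_ : ℕ.NonZero (m ℕ.* n)}} →
            (+ 1 / m) * (+ 1 / n) ≡ + 1 / (m ℕ.* n)
  recip-* (suc m) (suc n) = ℚ.toℚᵘ-injective (begin
    ℚ.toℚᵘ ((+ 1 / suc m) * (+ 1 / suc n))              ≈⟨ ℚ.toℚᵘ-homo-* (+ 1 / suc m) (+ 1 / suc n) ⟩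
    ℚ.toℚᵘ (+ 1 / suc m) ℚᵘ.* ℚ.toℚᵘ (+ 1 / suc n)
      ≈⟨ ℚᵘ.*-cong (ℚ.toℚᵘ-fromℚᵘ (mkℚᵘ (+ 1) m)) (ℚ.toℚᵘ-fromℚᵘ (mkℚᵘ (+ 1) n)) ⟩
    mkℚᵘ (+ 1) m ℚᵘ.* mkℚᵘ (+ 1) n                      ≈⟨ ℚᵘ.≃-sym (ℚ.toℚᵘ-fromℚᵘ (mkℚᵘ (+ 1) (n ℕ.+ m ℕ.* suc n))) ⟩
    ℚ.toℚᵘ (+ 1 / (suc m ℕ.* suc n))                    ∎)
    where open ℚᵘ.≃-Reasoning

  suc/1 : ∀ n → + suc n / 1 ≡ 1ℚ + + n / 1
  suc/1 n = ℚ.toℚᵘ-injective (begin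
    ℚ.toℚᵘ (+ suc n / 1)                    ≈⟨ ℚ.toℚᵘ-fromℚᵘ (mkℚᵘ (+ suc n) 0) ⟩
    mkℚᵘ (+ suc n) 0                        ≈⟨ *≡* (cong (λ i → (+ 1 ℤ.+ i) ℤ.* + 1) (sym (ℤ.*-identityʳ (+ n)))) ⟩
    ℚᵘ.1ℚᵘ ℚᵘ.+ mkℚᵘ (+ n) 0                ≈⟨ ℚᵘ.+-congʳ ℚᵘ.1ℚᵘ (ℚᵘ.≃-sym (ℚ.toℚᵘ-fromℚᵘ (mkℚᵘ (+ n) 0))) ⟩
    ℚ.toℚᵘ 1ℚ ℚᵘ.+ ℚ.toℚᵘ (+ n / 1)         ≈⟨ ℚᵘ.≃-sym (ℚ.toℚᵘ-homo-+ 1ℚ (+ n / 1)) ⟩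
    ℚ.toℚᵘ (1ℚ + + n / 1)                   ∎)
    where open ℚᵘ.≃-Reasoning

  0≤n/1 : ∀ n → 0ℚ ≤ + n / 1
  0≤n/1 n = ℚ.nonNegative⁻¹ (+ n / 1) {{ℚ.normalize-nonNeg n 1}}

  0≤1/n : ∀ n .{{_ : ℕ.NonZero n}} → 0ℚ ≤ + 1 / n
  0≤1/n n = ℚ.nonNegative⁻¹ (+ 1 / n) {{ℚ.normalize-nonNeg 1 n}}

  archimedean : ∀ p → ∃[ n ] (p ≤ + n / 1)
  archimedean p@(ℚ.mkℚ i d _) = ℤ.∣ i ∣ , ℚ.toℚᵘ-cancel-≤ (begin
    ℚ.toℚᵘ p                      ≤⟨ *≤* (bound i) ⟩
    mkℚᵘ (+ ℤ.∣ i ∣) 0            ≃⟨ ℚᵘ.≃-sym (ℚ.toℚᵘ-fromℚᵘ (mkℚᵘ (+ ℤ.∣ i ∣) 0)) ⟩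
    ℚ.toℚᵘ (+ ℤ.∣ i ∣ / 1)        ∎)
    where
    open ℚᵘ.≤-Reasoning
    bound : ∀ i → i ℤ.* + 1 ℤ.≤ + ℤ.∣ i ∣ ℤ.* + suc d
    bound (+ n) = subst₂ ℤ._≤_ (ℤ.pos-* n 1) (ℤ.pos-* n (suc d))
      (ℤ.+≤+ (ℕ.*-monoʳ-≤ n (ℕ.s≤s ℕ.z≤n)))
    bound -[1+ n ] = ℤ.-≤+

  ratio≤½ : ∀ M k → M ℕ.* 2 ℕ.≤ suc k → (+ M / 1) * (+ 1 / suc k) ≤ ½
  ratio≤½ M k 2M≤ = ℚ.toℚᵘ-cancel-≤ (begin
    ℚ.toℚᵘ ((+ M / 1) * (+ 1 / suc k))              ≃⟨ ℚ.toℚᵘ-homo-* (+ M / 1) (+ 1 / suc k) ⟩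
    ℚ.toℚᵘ (+ M / 1) ℚᵘ.* ℚ.toℚᵘ (+ 1 / suc k)
      ≃⟨ ℚᵘ.*-cong (ℚ.toℚᵘ-fromℚᵘ (mkℚᵘ (+ M) 0)) (ℚ.toℚᵘ-fromℚᵘ (mkℚᵘ (+ 1) k)) ⟩
    mkℚᵘ (+ M) 0 ℚᵘ.* mkℚᵘ (+ 1) k                  ≤⟨ *≤* bound ⟩
    ℚ.toℚᵘ ½                                        ∎)
    where
    open ℚᵘ.≤-Reasoning
    bound : (+ M ℤ.* + 1) ℤ.* + 2 ℤ.≤ + 1 ℤ.* + (1 ℕ.* suc k)
    bound = subst₂ ℤ._≤_
      (trans (ℤ.pos-* M 2) (cong (ℤ._* + 2) (sym (ℤ.*-identityʳ (+ M)))))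
      (trans (cong +_ (sym (ℕ.*-identityˡ (suc k)))) (sym (ℤ.*-identityˡ (+ (1 ℕ.* suc k)))))
      (ℤ.+≤+ 2M≤)

  module Convergence (q : ℚ) where

    expTerm-suc : ∀ k → expTerm q (suc k) ≡ (q * (+ 1 / suc k)) * expTerm q k
    expTerm-suc k = begin
      (q * q ^ k) * r (suc k)                          ≡⟨ cong ((q * q ^ k) *_) (sym (recip-* (suc k) (k !)
                                                            {{_}} {{k ℕ.!≢0}} {{suc k ℕ.!≢0}})) ⟩
      (q * q ^ k) * ((+ 1 / suc k) * r k)              ≡⟨ lemma q (q ^ k) (+ 1 / suc k) (r k) ⟩
      (q * (+ 1 / suc k)) * (q ^ k * r k)              ∎
      where
      open ≡-Reasoning
      r : ℕ → ℚ
      r k = _/_ (+ 1) (k !) {{k ℕ.!≢0}}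
      lemma : ∀ a b c d → (a * b) * (c * d) ≡ (a * c) * (b * d)
      lemma = solve 4 (λ a b c d → (a :* b) :* (c :* d) := (a :* c) :* (b :* d)) refl
        where open +-*-Solver

    M : ℕ
    M = proj₁ (archimedean ℚ.∣ q ∣)

    K : ℕ
    K = M ℕ.* 2

    a : ℕ → ℚ
    a k = ℚ.∣ expTerm q k ∣

    0≤a : ∀ k → 0ℚ ≤ a k
    0≤a k = ℚ.0≤∣p∣ (expTerm q k)

    a-suc≤ : ∀ k → K ℕ.≤ k → a (suc k) ≤ ½ * a k
    a-suc≤ k K≤k = begin
      ℚ.∣ expTerm q (suc k) ∣                            ≡⟨ cong ℚ.∣_∣ (expTerm-suc k) ⟩
      ℚ.∣ (q * (+ 1 / suc k)) * expTerm q k ∣            ≡⟨ ℚ.∣p*q∣≡∣p∣*∣q∣ (q * (+ 1 / suc k)) (expTerm q k) ⟩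
      ℚ.∣ q * (+ 1 / suc k) ∣ * a k                      ≡⟨ cong (_* a k) (ℚ.∣p*q∣≡∣p∣*∣q∣ q (+ 1 / suc k)) ⟩
      ℚ.∣ q ∣ * ℚ.∣ + 1 / suc k ∣ * a k                  ≡⟨ cong (λ h → ℚ.∣ q ∣ * h * a k) (ℚ.0≤p⇒∣p∣≡p (0≤1/n (suc k))) ⟩
      ℚ.∣ q ∣ * (+ 1 / suc k) * a k                      ≤⟨ ℚ.*-monoʳ-≤-nonNeg (a k) {{toNonNeg (0≤a k)}} ratio ⟩
      ½ * a k                                            ∎
      where
      open ℚ.≤-Reasoning
      ratio : ℚ.∣ q ∣ * (+ 1 / suc k) ≤ ½
      ratio = ℚ.≤-trans
        (ℚ.*-monoʳ-≤-nonNeg (+ 1 / suc k) {{toNonNeg (0≤1/n (suc k))}} (proj₂ (archimedean ℚ.∣ q ∣)))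
        (ratio≤½ M k (ℕ.m≤n⇒m≤1+n K≤k))

    -- From index K on, terms at least halve; comparison with a geometric series.
    tail : ∀ n d → K ℕ.≤ n →
           ℚ.∣ expSum q (d ℕ.+ n) - expSum q n ∣ + (a (d ℕ.+ n) + a (d ℕ.+ n)) ≤ a n + a n
    tail n zero    K≤n = ℚ.≤-reflexive (trans
      (cong (λ h → ℚ.∣ h ∣ + (a n + a n)) (p-p≡0 (expSum q n))) (ℚ.+-identityˡ (a n + a n)))
    tail n (suc d) K≤n = begin
      ℚ.∣ (s + t) - s₀ ∣ + (a (suc e) + a (suc e))      ≤⟨ ℚ.+-mono-≤ first (ℚ.+-mono-≤ next next) ⟩
      (ℚ.∣ s - s₀ ∣ + a e) + (half (a e) + half (a e))   ≡⟨ cong (λ h → (ℚ.∣ s - s₀ ∣ + a e) + h) (half+half (a e)) ⟩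
      (ℚ.∣ s - s₀ ∣ + a e) + a e                        ≡⟨ ℚ.+-assoc ℚ.∣ s - s₀ ∣ (a e) (a e) ⟩
      ℚ.∣ s - s₀ ∣ + (a e + a e)                        ≤⟨ tail n d K≤n ⟩
      a n + a n                                         ∎
      where
      open ℚ.≤-Reasoning
      e  = d ℕ.+ n
      s  = expSum q e
      t  = expTerm q e
      s₀ = expSum q n
      next : a (suc e) ≤ half (a e)
      next = a-suc≤ e (ℕ.≤-trans K≤n (ℕ.m≤n+m n d))
      lemma : ∀ x y z → (x + y) - z ≡ (x - z) + y
      lemma = solve 3 (λ x y z → (x :+ y) :- z := (x :- z) :+ y) refl
        where open +-*-Solver
      first : ℚ.∣ (s + t) - s₀ ∣ ≤ ℚ.∣ s - s₀ ∣ + a e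
      first = subst (λ h → ℚ.∣ h ∣ ≤ ℚ.∣ s - s₀ ∣ + a e) (sym (lemma s t s₀))
        (ℚ.∣p+q∣≤∣p∣+∣q∣ (s - s₀) t)

    decay : ∀ d → (+ suc d / 1) * a (d ℕ.+ K) ≤ a K
    decay zero    = ℚ.≤-reflexive (ℚ.*-identityˡ (a K))
    decay (suc d) = begin
      (+ suc (suc d) / 1) * a (suc e)     ≤⟨ ℚ.*-monoˡ-≤-nonNeg (+ suc (suc d) / 1) {{toNonNeg (0≤n/1 (suc (suc d)))}}
                                               (a-suc≤ e (ℕ.m≤n+m K d)) ⟩
      (+ suc (suc d) / 1) * (½ * a e)     ≡⟨ ℚ.*-assoc (+ suc (suc d) / 1) ½ (a e) ⟨
      (+ suc (suc d) / 1) * ½ * a e       ≤⟨ ℚ.*-monoʳ-≤-nonNeg (a e) {{toNonNeg (0≤a e)}} coeff ⟩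
      (+ suc d / 1) * a e                 ≤⟨ decay d ⟩
      a K                                 ∎
      where
      open ℚ.≤-Reasoning
      e = d ℕ.+ K
      x = + d / 1
      lemma : ∀ x → (1ℚ + (1ℚ + x)) * ½ + ½ * x ≡ 1ℚ + x
      lemma = solve 1 (λ x → (con 1ℚ :+ (con 1ℚ :+ x)) :* con ½ :+ con ½ :* x := con 1ℚ :+ x) refl
        where open +-*-Solver
      0≤½x : 0ℚ ≤ ½ * x
      0≤½x = subst (_≤ ½ * x) (ℚ.*-zeroʳ ½) (ℚ.*-monoˡ-≤-nonNeg ½ (0≤n/1 d))
      coeff : (+ suc (suc d) / 1) * ½ ≤ + suc d / 1
      coeff = begin
        (+ suc (suc d) / 1) * ½           ≡⟨ cong (_* ½) (trans (suc/1 (suc d)) (cong (λ h → 1ℚ + h) (suc/1 d))) ⟩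
        (1ℚ + (1ℚ + x)) * ½               ≤⟨ p≤p+ε ((1ℚ + (1ℚ + x)) * ½) 0≤½x ⟩
        (1ℚ + (1ℚ + x)) * ½ + ½ * x       ≡⟨ lemma x ⟩
        1ℚ + x                            ≡⟨ suc/1 d ⟨
        + suc d / 1                       ∎

    small : ∀ ε → 0ℚ < ε → ∃[ n ] (K ℕ.≤ n × a n + a n ≤ ε)
    small ε 0<ε = D ℕ.+ K , ℕ.m≤n+m K D , ℚ.*-cancelˡ-≤-pos L {{ℚ.normalize-pos (suc D) 1}} (begin
      L * (a e + a e)             ≡⟨ ℚ.*-distribˡ-+ L (a e) (a e) ⟩
      L * a e + L * a e           ≤⟨ ℚ.+-mono-≤ (decay D) (decay D) ⟩
      a K + a K                   ≤⟨ p≤p+ε (a K + a K) 0≤1 ⟩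
      (a K + a K) + 1ℚ            ≡⟨ proj₂ (proj₂ quotient) ⟨
      ε * δ                       ≤⟨ ℚ.*-monoˡ-≤-nonNeg ε {{toNonNeg (ℚ.<⇒≤ 0<ε)}} δ≤L ⟩
      ε * L                       ≡⟨ ℚ.*-comm ε L ⟩
      L * ε                       ∎)
      where
      open ℚ.≤-Reasoning
      0≤1 : 0ℚ ≤ 1ℚ
      0≤1 = ℚ.<⇒≤ (ℚ.positive⁻¹ 1ℚ)
      c>0 : 0ℚ < (a K + a K) + 1ℚ
      c>0 = ℚ.+-mono-≤-< (ℚ.+-mono-≤ (0≤a K) (0≤a K)) (ℚ.positive⁻¹ 1ℚ)
      quotient = divide 0<ε c>0
      δ : ℚ
      δ = proj₁ quotient
      D : ℕ
      D = proj₁ (archimedean δ)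
      e : ℕ
      e = D ℕ.+ K
      L : ℚ
      L = + suc D / 1
      δ≤L : δ ≤ L
      δ≤L = ℚ.≤-trans (proj₂ (archimedean δ)) (subst (+ D / 1 ≤_)
        (trans (ℚ.+-comm (+ D / 1) 1ℚ) (sym (suc/1 D))) (p≤p+ε (+ D / 1) 0≤1))

    expSum-isCauchy : IsCauchy (expSum q)
    expSum-isCauchy = mkCauchy (expSum q) λ ε 0<ε → let N , K≤N , 2a≤ε = small ε 0<ε in
      N , λ m N≤m → ℚ.≤-trans
        (subst (λ k → ℚ.∣ expSum q k - expSum q N ∣ ≤ a N + a N) (ℕ.m∸n+n≡m N≤m)
          (ℚ.≤-trans (p≤p+ε _ (ℚ.+-mono-≤ (0≤a (m ℕ.∸ N ℕ.+ N)) (0≤a (m ℕ.∸ N ℕ.+ N))))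
            (tail N (m ℕ.∸ N) K≤N)))
        2a≤ε

-- The real number e^q.
exp : ℚ → ℝ
exp q = mkℝ (expSum q) (Convergence.expSum-isCauchy q)

-- Closed intervals.  For simple chains the choice of endpoints is immaterial:
-- selections depend only on which pairs of intervals overlap.
record Interval : Set where
  constructor ⟦_,_⟧
  field
    left right : ℝ

open Interval public

infix 4 _∈ᵢ_

_∈ᵢ_ : ℝ → Interval → Set
x ∈ᵢ I = left I ≤ᵣ x × x ≤ᵣ right I

Overlap : Interval → Interval → Set
Overlap I J = ∃[ x ] (x ∈ᵢ I × x ∈ᵢ J)

UnitLength : Interval → Set
UnitLength I = right I ≃ᵣ left I +ᵣ 1ᵣ

record SimpleChain (n : ℕ) : Set where
  field
    interval   : Fin n → Interval
    unitLength : ∀ i → UnitLength (interval i)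
    increasing : ∀ {i j} → i Fin.< j → left (interval i) <ᵣ left (interval j)
    path       : ∀ {i j} → i ≢ j →
                 Overlap (interval i) (interval j) ⇔ ℕ.∣ toℕ i - toℕ j ∣ ≡ 1

private
  ≤ᵣ-refl : ∀ x → x ≤ᵣ x
  ≤ᵣ-refl x ε 0<ε = 0 , λ n _ → p≤p+ε (seq x n) (ℚ.<⇒≤ 0<ε)

  selfOverlap : ∀ I → UnitLength I → Overlap I I
  selfOverlap I (_ , l+1≤r) = left I , left∈ , left∈
    where
    left∈ : left I ∈ᵢ I
    left∈ = ≤ᵣ-refl (left I) , λ ε 0<ε → let N , p = l+1≤r ε 0<ε in
      N , λ n N≤n → ℚ.≤-trans (p≤p+ε (seq (left I) n) (ℚ.<⇒≤ (ℚ.positive⁻¹ 1ℚ))) (p n N≤n)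

subsets : ∀ n → List (Subset n)
subsets zero    = [ [] ]
subsets (suc n) = map (inside ∷_) (subsets n) ++ map (outside ∷_) (subsets n)

insertions : ∀ {A : Set} → A → List A → List (List A)
insertions x []       = [ x ∷ [] ]
insertions x (y ∷ ys) = (x ∷ y ∷ ys) ∷ map (y ∷_) (insertions x ys)

-- All n ! rearrangements of a list of length n, by position: for a list without
-- repetitions each rearrangement is listed exactly once.
permutations : ∀ {A : Set} → List A → List (List A)
permutations []       = [ [] ]
permutations (x ∷ xs) = concatMap (insertions x) (permutations xs)

-- The expected value of f on a uniformly random arrival order.
𝔼 : ∀ n → (List (Fin n) → ℕ) → ℚ
𝔼 n f = _/_ (+ sum (map f (permutations (allFin n)))) (n !) {{n ℕ.!≢0}}

module _ {n : ℕ} (C : SimpleChain n) where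

  open SimpleChain C

  -- Overlap of real intervals is not decidable in general; in a simple chain it
  -- is, because the overlaps are prescribed.
  overlap? : ∀ i j → Dec (Overlap (interval i) (interval j))
  overlap? i j with i Fin.≟ j
  ... | yes refl = yes (selfOverlap (interval i) (unitLength i))
  ... | no i≢j   = map′ (Equivalence.from (path i≢j)) (Equivalence.to (path i≢j))
                        (ℕ.∣ toℕ i - toℕ j ∣ ℕ.≟ 1)

  Independent : Subset n → Set
  Independent S = ∀ i j → i ∈ S → j ∈ S → i ≢ j → ¬ Overlap (interval i) (interval j)

  independent? : ∀ S → Dec (Independent S)
  independent? S = Fin.all? λ i → Fin.all? λ j →
    (i ∈? S) →-dec ((j ∈? S) →-dec (¬? (i Fin.≟ j) →-dec ¬? (overlap? i j)))

  OPT : ℕ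
  OPT = max 0 (map ∣_∣ (filter independent? (subsets n)))

  accept : List (Fin n) → Fin n → List (Fin n)
  accept selected i =
    if does (any? (overlap? i) selected) then selected else i ∷ selected

  greedy : List (Fin n) → List (Fin n)
  greedy σ = foldl accept [] σ

  ALG : List (Fin n) → ℕ
  ALG σ = length (greedy σ)

Achieves : ℝ → Set
Achieves ρ = ∃[ b ] (∀ n → 1 ℕ.≤ n → (C : SimpleChain n) →
  ρ *ᵣ fromℕ (OPT C) -ᵣ b ≤ᵣ fromℚ (𝔼 n (ALG C)))

IsCompetitiveRatio : ℝ → Set
IsCompetitiveRatio ρ = Achieves ρ × (∀ ρ′ → Achieves ρ′ → ρ′ ≤ᵣ ρ)

{-# OPTIONS --safe #-}
module Submission where

-- Let Eₙ be the expected number of intervals that greedy accepts on a chain of size n.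
-- Once the first arrival i is accepted, its neighbours are dead and the chain falls apart
-- into two chains of sizes i − 2 and n − i − 1, each in uniformly random order, so
-- n Eₙ = n + 2 (E₀ + … + Eₙ₋₂).  The differences dₙ = Eₙ − Eₙ₋₁ then satisfy
-- (n + 1)(dₙ₊₁ − dₙ) = −2 (dₙ − dₙ₋₁), hence 2 dₙ = 1 − Σ_{k ≤ n} (−2)ᵏ / k!, and Eₙ is a
-- combination of two such partial sums.  The terms of the series eventually halve, so
-- 2 Eₙ and n (1 − e⁻²) differ by a bounded amount, whereas OPT = ⌈n / 2⌉.

open import Defs
open import Data.Bool.Base using (Bool; true; false; not; _∨_; if_then_else_)
open import Data.Bool.Properties using (∨-comm; ∨-identityʳ)
open import Data.Empty using (⊥-elim)
open import Data.Fin.Base as Fin using (Fin; toℕ)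
import Data.Fin.Properties as Fin
open import Data.Fin.Subset using (Subset; inside; outside; _∈_; ∣_∣)
open import Data.Integer.Base as ℤ using (+_; -[1+_])
import Data.Integer.Properties as ℤ
open import Data.List.Base
  using (List; []; _∷_; _++_; map; concatMap; filterᵇ; foldl; length; allFin; tabulate)
import Data.List.Extrema.Nat as List
import Data.List.Membership.Propositional as List
import Data.List.Membership.Propositional.Properties as List
open import Data.List.Properties using (map-++; map-∘; length-++; ++-assoc; ++-identityʳ)
open import Data.List.Relation.Binary.Permutation.Propositional as ↭ using (_↭_)
import Data.List.Relation.Binary.Permutation.Propositional.Properties as ↭
open import Data.List.Relation.Unary.All as All using (All; []; _∷_)
import Data.List.Relation.Unary.All.Properties as All
open import Data.List.Relation.Unary.Any as Any using (any?)
open import Data.Nat.Base as ℕ using (ℕ; zero; suc; _!; _∸_)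
open import Data.Nat.ListAction using (sum)
open import Data.Nat.ListAction.Properties using (sum-++)
import Data.Nat.Properties as ℕ
open import Data.Product.Base using (∃-syntax; _×_; _,_; proj₁; proj₂)
open import Data.Rational.Base as ℚ
  using (ℚ; 0ℚ; 1ℚ; ½; _/_; _+_; _*_; _-_; -_; _≤_; _<_)
import Data.Rational.Properties as ℚ
open import Data.Rational.Solver using (module +-*-Solver)
open import Data.Rational.Unnormalised.Base as ℚᵘ using (mkℚᵘ; *≡*)
import Data.Rational.Unnormalised.Properties as ℚᵘ
open import Data.Sum.Base using (_⊎_; inj₁; inj₂)
open import Data.Vec.Base using (_∷_; []; here; there)
open import Function.Base using (_∘_; const; id)
open import Function.Bundles using (mk⇔; Equivalence)
open import Relation.Binary.PropositionalEquality
  using (_≡_; _≢_; refl; sym; trans; cong; cong₂; subst; subst₂; module ≡-Reasoning)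
open import Relation.Nullary using (Dec; yes; no; ¬_; does)
open import Relation.Nullary.Decidable using (dec-true; dec-false; toWitness)

open import Algebra.Definitions.RawSemiring ℚ.+-*-rawSemiring using (_^_)
open +-*-Solver using (solve; con; _:+_; _:*_; _:-_; _:=_; :-_)

-- The two sides of the first arrival are linked only by linearity of the mean: the count splits
-- into two summands, each of which sees one side, and deleting the unseen elements one at a time
-- keeps the order uniform (`mean-ignored`). A chain enters only through its conflict pattern, so
-- the counting takes place on integer segments; their start stays free because the right-hand side
-- does not begin at 0. The formula in partial sums is checked against the recursion, and no limit
-- is ever taken: the k-th approximation of 1 - e⁻² is `1ℚ - S k`, and all estimates compare
-- rationals, uniformly in k ≥ n + 3. The obstacle is that the error of the partial sum gets
-- multiplied by n; the relation k t(k) = -2 t(k - 1) absorbs this factor. For optimality, a bounded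
-- additive error is outweighed by a long chain, so chains of arbitrary size must be exhibited; even
-- sizes avoid rounding in OPT.

+-interchange : ∀ a b c d → a + b + (c + d) ≡ a + c + (b + d)
+-interchange = solve 4 (λ a b c d → a :+ b :+ (c :+ d) := a :+ c :+ (b :+ d)) refl

-- Natural numbers and reciprocal factorials as rationals

ι : ℕ → ℚ
ι n = + n / 1

/-as-* : ∀ a m .{{_ : ℕ.NonZero m}} → + a / m ≡ ι a * (+ 1 / m)
/-as-* a (suc m) = ℚ.toℚᵘ-injective (begin
  ℚ.toℚᵘ (+ a / suc m)                        ≈⟨ ℚ.toℚᵘ-fromℚᵘ (mkℚᵘ (+ a) m) ⟩
  mkℚᵘ (+ a) m                                ≈⟨ *≡* (cong₂ ℤ._*_ (sym (ℤ.*-identityʳ (+ a))) (cong +_ (ℕ.*-identityˡ (suc m)))) ⟩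
  mkℚᵘ (+ a) 0 ℚᵘ.* mkℚᵘ (+ 1) m
    ≈⟨ ℚᵘ.*-cong (ℚ.toℚᵘ-fromℚᵘ (mkℚᵘ (+ a) 0)) (ℚ.toℚᵘ-fromℚᵘ (mkℚᵘ (+ 1) m)) ⟨
  ℚ.toℚᵘ (ι a) ℚᵘ.* ℚ.toℚᵘ (+ 1 / suc m)      ≈⟨ ℚ.toℚᵘ-homo-* (ι a) (+ 1 / suc m) ⟨
  ℚ.toℚᵘ (ι a * (+ 1 / suc m))                ∎)
  where open ℚᵘ.≃-Reasoning

ι-+ : ∀ m n → ι (m ℕ.+ n) ≡ ι m + ι n
ι-+ m n = ℚ.toℚᵘ-injective (begin
  ℚ.toℚᵘ (ι (m ℕ.+ n))                 ≈⟨ ℚ.toℚᵘ-fromℚᵘ (mkℚᵘ (+ (m ℕ.+ n)) 0) ⟩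
  mkℚᵘ (+ (m ℕ.+ n)) 0                 ≈⟨ *≡* (cong (ℤ._* + 1) (cong₂ ℤ._+_ (sym (ℤ.*-identityʳ (+ m))) (sym (ℤ.*-identityʳ (+ n))))) ⟩
  mkℚᵘ (+ m) 0 ℚᵘ.+ mkℚᵘ (+ n) 0
    ≈⟨ ℚᵘ.+-cong (ℚ.toℚᵘ-fromℚᵘ (mkℚᵘ (+ m) 0)) (ℚ.toℚᵘ-fromℚᵘ (mkℚᵘ (+ n) 0)) ⟨
  ℚ.toℚᵘ (ι m) ℚᵘ.+ ℚ.toℚᵘ (ι n)       ≈⟨ ℚ.toℚᵘ-homo-+ (ι m) (ι n) ⟨
  ℚ.toℚᵘ (ι m + ι n)                   ∎)
  where open ℚᵘ.≃-Reasoning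

ι-* : ∀ m n → ι (m ℕ.* n) ≡ ι m * ι n
ι-* zero    n = sym (ℚ.*-zeroˡ (ι n))
ι-* (suc m) n = begin
  ι (n ℕ.+ m ℕ.* n)       ≡⟨ ι-+ n (m ℕ.* n) ⟩
  ι n + ι (m ℕ.* n)       ≡⟨ cong (λ h → ι n + h) (ι-* m n) ⟩
  ι n + ι m * ι n         ≡⟨ solve 2 (λ m n → n :+ m :* n := (con 1ℚ :+ m) :* n) refl (ι m) (ι n) ⟩
  (1ℚ + ι m) * ι n        ≡⟨ cong (_* ι n) (ι-+ 1 m) ⟨
  ι (suc m) * ι n         ∎
  where open ≡-Reasoning

0≤ι : ∀ n → 0ℚ ≤ ι n
0≤ι n = ℚ.nonNegative⁻¹ (ι n) {{ℚ.normalize-nonNeg n 1}}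

ι-mono-≤ : ∀ {m n} → m ℕ.≤ n → ι m ≤ ι n
ι-mono-≤ {m} {n} m≤n = subst (ι m ≤_) (trans (sym (ι-+ m (n ∸ m))) (cong ι (ℕ.m+[n∸m]≡n m≤n)))
  (ℚ.≤-trans (ℚ.≤-reflexive (sym (ℚ.+-identityʳ (ι m)))) (ℚ.+-monoʳ-≤ (ι m) (0≤ι (n ∸ m))))

ι*recip : ∀ m .{{_ : ℕ.NonZero m}} → ι m * (+ 1 / m) ≡ 1ℚ
ι*recip (suc m) = trans (sym (/-as-* (suc m) (suc m)))
  (ℚ.toℚᵘ-injective (ℚᵘ.≃-trans (ℚ.toℚᵘ-fromℚᵘ (mkℚᵘ (+ suc m) m))
    (*≡* (ℤ.*-comm (+ suc m) (+ 1)))))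

invFact : ℕ → ℚ
invFact k = _/_ (+ 1) (k !) {{k ℕ.!≢0}}

ι*invFact : ∀ k → ι (suc k) * invFact (suc k) ≡ invFact k
ι*invFact k = begin
  s * r′                      ≡⟨ ℚ.*-identityˡ (s * r′) ⟨
  1ℚ * (s * r′)               ≡⟨ cong (_* (s * r′)) (ι*recip (k !) {{k ℕ.!≢0}}) ⟨
  f * r * (s * r′)            ≡⟨ solve 4 (λ f r s r′ → f :* r :* (s :* r′) := r :* (s :* f :* r′)) refl f r s r′ ⟩
  r * (s * f * r′)            ≡⟨ cong (λ h → r * (h * r′)) (ι-* (suc k) (k !)) ⟨
  r * (ι (suc k !) * r′)      ≡⟨ cong (r *_) (ι*recip (suc k !) {{suc k ℕ.!≢0}}) ⟩
  r * 1ℚ                      ≡⟨ ℚ.*-identityʳ r ⟩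
  r                           ∎
  where
  open ≡-Reasoning
  s  = ι (suc k)
  f  = ι (k !)
  r  = invFact k
  r′ = invFact (suc k)

-- Sums over arrival orders

-- The recursion follows `insertions` and `permutations`, with the summand as accumulator:
-- inductions run over the list itself instead of a list of n! orders, and rational values can be
-- rescaled.
sumInsertions : ∀ {A : Set} → A → (List A → ℚ) → List A → ℚ
sumInsertions x f []       = f (x ∷ [])
sumInsertions x f (y ∷ ys) = f (x ∷ y ∷ ys) + sumInsertions x (f ∘ (y ∷_)) ys

sumPerms : ∀ {A : Set} → (List A → ℚ) → List A → ℚ
sumPerms f []       = f []
sumPerms f (x ∷ xs) = sumPerms (sumInsertions x f) xs

sum-concatMap : ∀ {A B : Set} (g : B → ℕ) (h : A → List B) xs →
                sum (map g (concatMap h xs)) ≡ sum (map (λ x → sum (map g (h x))) xs)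
sum-concatMap g h []       = refl
sum-concatMap g h (x ∷ xs) = trans (cong sum (map-++ g (h x) (concatMap h xs)))
  (trans (sum-++ (map g (h x)) _) (cong (sum (map g (h x)) ℕ.+_) (sum-concatMap g h xs)))

module _ {A : Set} where

  sum-insertions : ∀ (g : List A → ℕ) x σ →
                   ι (sum (map g (insertions x σ))) ≡ sumInsertions x (ι ∘ g) σ
  sum-insertions g x []      = cong ι (ℕ.+-identityʳ (g (x ∷ [])))
  sum-insertions g x (y ∷ σ) = begin
    ι (g (x ∷ y ∷ σ) ℕ.+ sum (map g (map (y ∷_) (insertions x σ))))
      ≡⟨ ι-+ (g (x ∷ y ∷ σ)) _ ⟩
    ι (g (x ∷ y ∷ σ)) + ι (sum (map g (map (y ∷_) (insertions x σ))))
      ≡⟨ cong (λ h → ι (g (x ∷ y ∷ σ)) + ι (sum h)) (map-∘ (insertions x σ)) ⟨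
    ι (g (x ∷ y ∷ σ)) + ι (sum (map (g ∘ (y ∷_)) (insertions x σ)))
      ≡⟨ cong (λ h → ι (g (x ∷ y ∷ σ)) + h) (sum-insertions (g ∘ (y ∷_)) x σ) ⟩
    ι (g (x ∷ y ∷ σ)) + sumInsertions x (ι ∘ g ∘ (y ∷_)) σ ∎
    where open ≡-Reasoning

  sumInsertions-cong : ∀ {f h : List A → ℚ} x σ → (∀ τ → τ ↭ x ∷ σ → f τ ≡ h τ) →
                       sumInsertions x f σ ≡ sumInsertions x h σ
  sumInsertions-cong x []      f≡h = f≡h (x ∷ []) ↭.refl
  sumInsertions-cong x (y ∷ σ) f≡h = cong₂ _+_ (f≡h (x ∷ y ∷ σ) ↭.refl)
    (sumInsertions-cong x σ λ τ τ↭ →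
      f≡h (y ∷ τ) (↭.trans (↭.prep y τ↭) (↭.swap y x ↭.refl)))

  sumPerms-cong : ∀ {f h : List A → ℚ} xs → (∀ σ → σ ↭ xs → f σ ≡ h σ) →
                  sumPerms f xs ≡ sumPerms h xs
  sumPerms-cong []       f≡h = f≡h [] ↭.refl
  sumPerms-cong (x ∷ xs) f≡h = sumPerms-cong xs λ σ σ↭ →
    sumInsertions-cong x σ λ τ τ↭ → f≡h τ (↭.trans τ↭ (↭.prep x σ↭))

  sum-permutations : ∀ (g : List A → ℕ) xs →
                     ι (sum (map g (permutations xs))) ≡ sumPerms (ι ∘ g) xs
  sum-permutations g []       = cong ι (ℕ.+-identityʳ (g []))
  sum-permutations g (x ∷ xs) = begin
    ι (sum (map g (concatMap (insertions x) (permutations xs))))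
      ≡⟨ cong ι (sum-concatMap g (insertions x) (permutations xs)) ⟩
    ι (sum (map (λ σ → sum (map g (insertions x σ))) (permutations xs)))
      ≡⟨ sum-permutations (λ σ → sum (map g (insertions x σ))) xs ⟩
    sumPerms (λ σ → ι (sum (map g (insertions x σ)))) xs
      ≡⟨ sumPerms-cong xs (λ σ _ → sum-insertions g x σ) ⟩
    sumPerms (sumInsertions x (ι ∘ g)) xs ∎
    where open ≡-Reasoning

  sumInsertions-+ : ∀ (f h : List A → ℚ) x σ →
    sumInsertions x (λ τ → f τ + h τ) σ ≡ sumInsertions x f σ + sumInsertions x h σ
  sumInsertions-+ f h x []      = refl
  sumInsertions-+ f h x (y ∷ σ) = trans
    (cong (λ k → f (x ∷ y ∷ σ) + h (x ∷ y ∷ σ) + k) (sumInsertions-+ (f ∘ (y ∷_)) (h ∘ (y ∷_)) x σ))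
    (+-interchange (f (x ∷ y ∷ σ)) (h (x ∷ y ∷ σ)) _ _)

  sumPerms-+ : ∀ (f h : List A → ℚ) xs →
               sumPerms (λ σ → f σ + h σ) xs ≡ sumPerms f xs + sumPerms h xs
  sumPerms-+ f h []       = refl
  sumPerms-+ f h (x ∷ xs) = trans
    (sumPerms-cong xs (λ σ _ → sumInsertions-+ f h x σ))
    (sumPerms-+ (sumInsertions x f) (sumInsertions x h) xs)

  -- Inserting both elements, in either succession, reaches the same arrangements. This is the swap
  -- case of `sumPerms-↭`, the only one with content.
  sumInsertions-comm : ∀ (f : List A → ℚ) x y σ →
    sumInsertions x (sumInsertions y f) σ ≡ sumInsertions y (sumInsertions x f) σ
  sumInsertions-comm f x y []      = ℚ.+-comm (f (y ∷ x ∷ [])) (f (x ∷ y ∷ []))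
  sumInsertions-comm f x y (z ∷ σ) = begin
    a + (b + c) + sumInsertions x (λ τ → f (y ∷ z ∷ τ) + sumInsertions y (f ∘ (z ∷_)) τ) σ
      ≡⟨ cong (λ h → a + (b + c) + h) (sumInsertions-+ (λ τ → f (y ∷ z ∷ τ)) _ x σ) ⟩
    a + (b + c) + (d + sumInsertions x (sumInsertions y (f ∘ (z ∷_))) σ)
      ≡⟨ cong (λ h → a + (b + c) + (d + h)) (sumInsertions-comm (f ∘ (z ∷_)) x y σ) ⟩
    a + (b + c) + (d + e)
      ≡⟨ solve 5 (λ a b c d e → a :+ (b :+ c) :+ (d :+ e) := b :+ (a :+ d) :+ (c :+ e)) refl a b c d e ⟩
    b + (a + d) + (c + e)
      ≡⟨ cong (λ h → b + (a + d) + h) (sumInsertions-+ (λ τ → f (x ∷ z ∷ τ)) _ y σ) ⟨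
    b + (a + d) + sumInsertions y (λ τ → f (x ∷ z ∷ τ) + sumInsertions x (f ∘ (z ∷_)) τ) σ ∎
    where
    open ≡-Reasoning
    a = f (y ∷ x ∷ z ∷ σ)
    b = f (x ∷ y ∷ z ∷ σ)
    c = sumInsertions y (λ τ → f (x ∷ z ∷ τ)) σ
    d = sumInsertions x (λ τ → f (y ∷ z ∷ τ)) σ
    e = sumInsertions y (sumInsertions x (f ∘ (z ∷_))) σ

  sumPerms-↭ : ∀ (f : List A → ℚ) {xs ys} → xs ↭ ys → sumPerms f xs ≡ sumPerms f ys
  sumPerms-↭ f ↭.refl            = refl
  sumPerms-↭ f (↭.prep x p)      = sumPerms-↭ (sumInsertions x f) p
  sumPerms-↭ f {ys = _ ∷ _ ∷ ys} (↭.swap x y p) = trans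
    (sumPerms-↭ (sumInsertions y (sumInsertions x f)) p)
    (sumPerms-cong ys (λ σ _ → sumInsertions-comm f y x σ))
  sumPerms-↭ f (↭.trans p q)     = trans (sumPerms-↭ f p) (sumPerms-↭ f q)

  -- There are `suc (length σ)` slots for `x`, and `f` has the same value for all of them.
  sumInsertions-ignored : ∀ (f h : List A → ℚ) x σ →
    (∀ as bs → f (as ++ x ∷ bs) ≡ h (as ++ bs)) →
    sumInsertions x f σ ≡ ι (suc (length σ)) * h σ
  sumInsertions-ignored f h x []      f≡h = trans (f≡h [] []) (sym (ℚ.*-identityˡ (h [])))
  sumInsertions-ignored f h x (y ∷ σ) f≡h = begin
    f (x ∷ y ∷ σ) + sumInsertions x (f ∘ (y ∷_)) σ
      ≡⟨ cong₂ _+_ (f≡h [] (y ∷ σ))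
           (sumInsertions-ignored (f ∘ (y ∷_)) (h ∘ (y ∷_)) x σ (λ as bs → f≡h (y ∷ as) bs)) ⟩
    h (y ∷ σ) + ι (suc (length σ)) * h (y ∷ σ)
      ≡⟨ solve 2 (λ h k → h :+ k :* h := (con 1ℚ :+ k) :* h) refl (h (y ∷ σ)) (ι (suc (length σ))) ⟩
    (1ℚ + ι (suc (length σ))) * h (y ∷ σ)
      ≡⟨ cong (_* h (y ∷ σ)) (ι-+ 1 (suc (length σ))) ⟨
    ι (suc (suc (length σ))) * h (y ∷ σ) ∎
    where open ≡-Reasoning

  sumInsertions-* : ∀ c (f : List A → ℚ) x σ →
                    sumInsertions x (λ τ → c * f τ) σ ≡ c * sumInsertions x f σ
  sumInsertions-* c f x []      = refl
  sumInsertions-* c f x (y ∷ σ) = trans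
    (cong (λ k → c * f (x ∷ y ∷ σ) + k) (sumInsertions-* c (f ∘ (y ∷_)) x σ))
    (sym (ℚ.*-distribˡ-+ c _ _))

  sumPerms-* : ∀ c (f : List A → ℚ) xs → sumPerms (λ σ → c * f σ) xs ≡ c * sumPerms f xs
  sumPerms-* c f []       = refl
  sumPerms-* c f (x ∷ xs) = trans
    (sumPerms-cong xs (λ σ _ → sumInsertions-* c f x σ)) (sumPerms-* c (sumInsertions x f) xs)

  -- Means over uniformly random orders

  mean : (List A → ℚ) → List A → ℚ
  mean f xs = invFact (length xs) * sumPerms f xs

  mean-+ : ∀ f h xs → mean (λ σ → f σ + h σ) xs ≡ mean f xs + mean h xs
  mean-+ f h xs = trans (cong (invFact (length xs) *_) (sumPerms-+ f h xs))
                        (ℚ.*-distribˡ-+ (invFact (length xs)) _ _)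

  mean-cong : ∀ {f h} xs → (∀ σ → σ ↭ xs → f σ ≡ h σ) → mean f xs ≡ mean h xs
  mean-cong xs f≡h = cong (invFact (length xs) *_) (sumPerms-cong xs f≡h)

  mean-↭ : ∀ f {xs ys} → xs ↭ ys → mean f xs ≡ mean f ys
  mean-↭ f p = cong₂ (λ n s → invFact n * s) (↭.↭-length p) (sumPerms-↭ f p)

  -- Deleting an element from a uniformly random order leaves a uniformly random order of the
  -- others: the number of slots for `x` cancels against the quotient of the two factorials.
  mean-ignored : ∀ f x xs → (∀ as bs → f (as ++ x ∷ bs) ≡ f (as ++ bs)) →
                 mean f (x ∷ xs) ≡ mean f xs
  mean-ignored f x xs f≡ = begin
    r′ * sumPerms (sumInsertions x f) xs
      ≡⟨ cong (r′ *_) (sumPerms-cong xs λ σ σ↭ → trans (sumInsertions-ignored f f x σ f≡)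
           (cong (λ n → ι (suc n) * f σ) (↭.↭-length σ↭))) ⟩
    r′ * sumPerms (λ σ → s * f σ) xs      ≡⟨ cong (r′ *_) (sumPerms-* s f xs) ⟩
    r′ * (s * sumPerms f xs)              ≡⟨ ℚ.*-assoc r′ s _ ⟨
    r′ * s * sumPerms f xs                ≡⟨ cong (_* sumPerms f xs) (trans (ℚ.*-comm r′ s) (ι*invFact (length xs))) ⟩
    mean f xs                             ∎
    where
    open ≡-Reasoning
    r′ = invFact (suc (length xs))
    s  = ι (suc (length xs))

  mean-const : ∀ c xs → mean (const c) xs ≡ c
  mean-const c []       = ℚ.*-identityˡ c
  mean-const c (x ∷ xs) = trans (mean-ignored (const c) x xs (λ _ _ → refl)) (mean-const c xs)

  filter-drop : ∀ (p : A → Bool) as x bs → p x ≡ false →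
                filterᵇ p (as ++ x ∷ bs) ≡ filterᵇ p (as ++ bs)
  filter-drop p []       x bs px rewrite px = refl
  filter-drop p (a ∷ as) x bs px with p a
  ... | true  = cong (a ∷_) (filter-drop p as x bs px)
  ... | false = filter-drop p as x bs px

  filter-id : ∀ (p : A → Bool) {xs} → All (λ x → p x ≡ true) xs → filterᵇ p xs ≡ xs
  filter-id p []         = refl
  filter-id p (px ∷ pxs) rewrite px = cong (_ ∷_) (filter-id p pxs)

  -- The order induced on a subset is again uniform: with the removed elements moved to the front of
  -- the list, `mean-ignored` discards them one by one.
  mean-filter : ∀ f (p : A → Bool) {xs} removed kept → xs ↭ removed ++ kept →
                All (λ x → p x ≡ false) removed → All (λ x → p x ≡ true) kept →
                mean (f ∘ filterᵇ p) xs ≡ mean f kept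
  mean-filter f p removed kept xs↭ ¬p p! = trans (mean-↭ _ xs↭) (go removed ¬p)
    where
    go : ∀ rs → All (λ x → p x ≡ false) rs → mean (f ∘ filterᵇ p) (rs ++ kept) ≡ mean f kept
    go []       []         = mean-cong kept λ σ σ↭ →
      cong f (filter-id p (↭.All-resp-↭ (↭.↭-sym σ↭) p!))
    go (r ∷ rs) (¬r ∷ ¬rs) = trans
      (mean-ignored _ r (rs ++ kept) (λ as bs → cong f (filter-drop p as r bs ¬r))) (go rs ¬rs)

  -- The remaining elements keep their order, so removing a vertex of a segment leaves a left
  -- segment followed by a right segment.
  sumSplits : (A → List A → ℚ) → List A → ℚ
  sumSplits F []       = 0ℚ
  sumSplits F (x ∷ xs) = F x xs + sumSplits (λ y ys → F y (x ∷ ys)) xs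

  sumSplits-+ : ∀ F G xs → sumSplits (λ y ys → F y ys + G y ys) xs ≡ sumSplits F xs + sumSplits G xs
  sumSplits-+ F G []       = refl
  sumSplits-+ F G (x ∷ xs) = trans
    (cong (λ k → F x xs + G x xs + k) (sumSplits-+ (λ y ys → F y (x ∷ ys)) (λ y ys → G y (x ∷ ys)) xs))
    (+-interchange (F x xs) (G x xs) _ _)

  sumSplits-* : ∀ c F xs → sumSplits (λ y ys → c * F y ys) xs ≡ c * sumSplits F xs
  sumSplits-* c F []       = sym (ℚ.*-zeroʳ c)
  sumSplits-* c F (x ∷ xs) = trans
    (cong (λ k → c * F x xs + k) (sumSplits-* c (λ y ys → F y (x ∷ ys)) xs))
    (sym (ℚ.*-distribˡ-+ c _ _))

  sumSplits-cong : ∀ {F G} xs → (∀ y ys → F y ys ≡ G y ys) → sumSplits F xs ≡ sumSplits G xs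
  sumSplits-cong []       F≡G = refl
  sumSplits-cong (x ∷ xs) F≡G = cong₂ _+_ (F≡G x xs) (sumSplits-cong xs λ y ys → F≡G y (x ∷ ys))

  -- Conditioning on the first arrival. Inserting `x` into an order that begins with `z` either puts
  -- `x` in front or leaves `z` there; the first kind is collected by the induction hypothesis, the
  -- second is `rest`.
  sumPerms-first : ∀ (f : List A → ℚ) x xs →
    sumPerms f (x ∷ xs) ≡ sumSplits (λ y ys → sumPerms (f ∘ (y ∷_)) ys) (x ∷ xs)
  sumPerms-first f x []       = sym (ℚ.+-identityʳ (f (x ∷ [])))
  sumPerms-first f x (y ∷ ys) = begin
    sumPerms (sumInsertions x f) (y ∷ ys)
      ≡⟨ sumPerms-first (sumInsertions x f) y ys ⟩
    sumSplits (λ z zs → sumPerms (λ σ → f (x ∷ z ∷ σ) + sumInsertions x (f ∘ (z ∷_)) σ) zs) (y ∷ ys)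
      ≡⟨ sumSplits-cong (y ∷ ys) (λ z zs → sumPerms-+ (λ σ → f (x ∷ z ∷ σ)) _ zs) ⟩
    sumSplits (λ z zs → sumPerms (λ σ → f (x ∷ z ∷ σ)) zs + sumPerms (f ∘ (z ∷_)) (x ∷ zs)) (y ∷ ys)
      ≡⟨ sumSplits-+ (λ z zs → sumPerms (λ σ → f (x ∷ z ∷ σ)) zs)
           (λ z zs → sumPerms (f ∘ (z ∷_)) (x ∷ zs)) (y ∷ ys) ⟩
    sumSplits (λ z zs → sumPerms (λ σ → f (x ∷ z ∷ σ)) zs) (y ∷ ys) + rest
      ≡⟨ cong (_+ rest) (sumPerms-first (f ∘ (x ∷_)) y ys) ⟨
    sumPerms (f ∘ (x ∷_)) (y ∷ ys) + rest ∎
    where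
    open ≡-Reasoning
    rest = sumSplits (λ z zs → sumPerms (f ∘ (z ∷_)) (x ∷ zs)) (y ∷ ys)

sumPerms-map : ∀ {A B : Set} (h : A → B) f xs → sumPerms (f ∘ map h) xs ≡ sumPerms f (map h xs)
sumPerms-map h f []       = refl
sumPerms-map h f (x ∷ xs) = trans
  (sumPerms-cong xs (λ σ _ → insertions-map f σ)) (sumPerms-map h (sumInsertions (h x) f) xs)
  where
  insertions-map : ∀ f σ → sumInsertions x (f ∘ map h) σ ≡ sumInsertions (h x) f (map h σ)
  insertions-map f []      = refl
  insertions-map f (y ∷ σ) = cong (λ k → f (h x ∷ h y ∷ map h σ) + k) (insertions-map (f ∘ (h y ∷_)) σ)

-- Greedy on integer segments

-- The vertices satisfying blocked are refused from the outset; c is the conflict relation.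
greedyCount : ∀ {A : Set} → (A → A → Bool) → (A → Bool) → List A → ℕ
greedyCount c blocked []      = 0
greedyCount c blocked (x ∷ σ) =
  if blocked x then greedyCount c blocked σ
  else suc (greedyCount c (λ y → blocked y ∨ c y x) σ)

∨-falseˡ : ∀ {a b} → a ∨ b ≡ false → a ≡ false
∨-falseˡ {false} _ = refl

module _ {A : Set} (c : A → A → Bool) where

  greedyCount-filter-blocked : ∀ d p x σ → (p x ≡ true → d x ≡ true) →
    greedyCount c d (filterᵇ p (x ∷ σ)) ≡ greedyCount c d (filterᵇ p σ)
  greedyCount-filter-blocked d p x σ px⇒dx with p x
  ... | false = refl
  ... | true  rewrite px⇒dx refl = refl

  -- An acceptance on one side conflicts with nothing on the other, so each side can keep its own
  -- predicate, which has to agree with `blocked` only there. Vertices that are already blocked may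
  -- lie on any side or on none; `cover` therefore speaks of the others alone.
  greedyCount-split : ∀ {blocked d₁ d₂ p q} →
    (∀ x → p x ≡ true → d₁ x ≡ blocked x) → (∀ x → q x ≡ true → d₂ x ≡ blocked x) →
    (∀ x y → p x ≡ true → q y ≡ true → c x y ≡ false × c y x ≡ false) →
    (∀ x → blocked x ≡ false → q x ≡ not (p x)) →
    ∀ σ → greedyCount c blocked σ ≡ greedyCount c d₁ (filterᵇ p σ) ℕ.+ greedyCount c d₂ (filterᵇ q σ)
  greedyCount-split d₁≡ d₂≡ sep cover []      = refl
  greedyCount-split {blocked} {d₁} {d₂} {p} {q} d₁≡ d₂≡ sep cover (x ∷ σ) with blocked x in bx
  ... | true  = trans (greedyCount-split d₁≡ d₂≡ sep cover σ) (sym (cong₂ ℕ._+_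
    (greedyCount-filter-blocked d₁ p x σ λ px → trans (d₁≡ x px) bx)
    (greedyCount-filter-blocked d₂ q x σ λ qx → trans (d₂≡ x qx) bx)))
  ... | false with p x in px | q x in qx | cover x bx
  ...   | true  | false | refl rewrite trans (d₁≡ x px) bx = cong suc
    (greedyCount-split
      (λ y py → cong (_∨ c y x) (d₁≡ y py))
      (λ y qy → trans (d₂≡ y qy) (sym (trans (cong (blocked y ∨_) (proj₂ (sep x y px qy))) (∨-identityʳ (blocked y)))))
      sep (λ y by → cover y (∨-falseˡ by)) σ)
  ...   | false | true  | refl rewrite trans (d₂≡ x qx) bx = trans (cong suc
    (greedyCount-split
      (λ y py → trans (d₁≡ y py) (sym (trans (cong (blocked y ∨_) (proj₁ (sep y x py qx))) (∨-identityʳ (blocked y)))))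
      (λ y qy → cong (_∨ c y x) (d₂≡ y qy))
      sep (λ y by → cover y (∨-falseˡ by)) σ)) (sym (ℕ.+-suc _ _))

close? : ∀ m n → Dec (ℕ.∣ m - n ∣ ℕ.≤ 1)
close? m n = ℕ.∣ m - n ∣ ℕ.≤? 1

close : ℕ → ℕ → Bool
close m n = does (close? m n)

-- Distance 0 counts as a conflict, in accordance with the diagonal of `overlap?`; off the diagonal,
-- distance at most 1 means distance 1.
does-overlap? : ∀ {n} (C : SimpleChain n) i j → does (overlap? C i j) ≡ close (toℕ i) (toℕ j)
does-overlap? C i j with i Fin.≟ j
... | yes refl = sym (dec-true (close? (toℕ i) (toℕ i)) (ℕ.≤-trans (ℕ.≤-reflexive (ℕ.∣n-n∣≡0 (toℕ i))) ℕ.z≤n))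
... | no i≢j   = ≟1≡≤1 ℕ.∣ toℕ i - toℕ j ∣ (λ eq → i≢j (Fin.toℕ-injective (ℕ.∣m-n∣≡0⇒m≡n eq)))
  where
  ≟1≡≤1 : ∀ k → k ≢ 0 → does (k ℕ.≟ 1) ≡ does (k ℕ.≤? 1)
  ≟1≡≤1 0             k≢0 = ⊥-elim (k≢0 refl)
  ≟1≡≤1 1             k≢0 = refl
  ≟1≡≤1 (suc (suc k)) k≢0 = refl

-- The invariant says that `blocked` is conflict with something already selected. From here on the
-- real endpoints are gone, and the count depends on positions only.
length-greedy : ∀ {n} (C : SimpleChain n) selected blocked →
  (∀ i → does (any? (overlap? C i) selected) ≡ blocked (toℕ i)) → ∀ σ →
  length (foldl (accept C) selected σ) ≡ length selected ℕ.+ greedyCount close blocked (map toℕ σ)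
length-greedy C selected blocked inv []      = sym (ℕ.+-identityʳ (length selected))
length-greedy C selected blocked inv (x ∷ σ) rewrite inv x with blocked (toℕ x)
... | true  = length-greedy C selected blocked inv σ
... | false = trans
  (length-greedy C (x ∷ selected) (λ y → blocked y ∨ close y (toℕ x))
    (λ i → trans (cong₂ _∨_ (does-overlap? C i x) (inv i)) (∨-comm (close (toℕ i) (toℕ x)) (blocked (toℕ i)))) σ)
  (sym (ℕ.+-suc (length selected) _))

far⇒¬close : ∀ m n → suc m ℕ.< n → ¬ ℕ.∣ m - n ∣ ℕ.≤ 1
far⇒¬close zero    n       m<n           n≤1 = ℕ.<⇒≱ m<n n≤1
far⇒¬close (suc m) (suc n) (ℕ.s≤s m<n)   d≤1 = far⇒¬close m n m<n d≤1

¬close⇒far : ∀ m n → ¬ ℕ.∣ m - n ∣ ℕ.≤ 1 → suc m ℕ.< n ⊎ suc n ℕ.< m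
¬close⇒far zero    n       ¬c = inj₁ (ℕ.≰⇒> ¬c)
¬close⇒far (suc m) zero    ¬c = inj₂ (ℕ.≰⇒> ¬c)
¬close⇒far (suc m) (suc n) ¬c with ¬close⇒far m n ¬c
... | inj₁ lt = inj₁ (ℕ.s≤s lt)
... | inj₂ lt = inj₂ (ℕ.s≤s lt)

close-sym : ∀ m n → close m n ≡ close n m
close-sym m n = cong (λ k → does (k ℕ.≤? 1)) (ℕ.∣-∣-comm m n)

far⇒close≡false : ∀ m n → suc m ℕ.< n → close m n ≡ false
far⇒close≡false m n m<n = dec-false (close? m n) (far⇒¬close m n m<n)

does-true : ∀ {P : Set} (P? : Dec P) → does P? ≡ true → P
does-true (yes p) _ = p

does-false : ∀ {P : Set} (P? : Dec P) → does P? ≡ false → ¬ P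
does-false (no ¬p) _ = ¬p

-- The gap of one leaves out `x` and its two neighbours, exactly the vertices that an accepted `x`
-- blocks.
leftOf rightOf : ℕ → ℕ → Bool
leftOf  x y = does (suc y ℕ.<? x)
rightOf x y = does (suc x ℕ.<? y)

greedySize : List ℕ → ℕ
greedySize = greedyCount close (const false)

-- Vertices left of the dead zone are at distance at least 4 from those right of it, so the two runs
-- never interact.
greedySize-∷ : ∀ x σ → greedySize (x ∷ σ) ≡
  suc (greedySize (filterᵇ (leftOf x) σ) ℕ.+ greedySize (filterᵇ (rightOf x) σ))
greedySize-∷ x σ = cong suc (greedyCount-split close
  (λ y l → sym (far⇒close≡false y x (left⁻ l)))
  (λ y r → sym (trans (close-sym y x) (far⇒close≡false x y (right⁻ r))))
  (λ y z l r → let y<z = far⇒close≡false y z (ℕ.<-trans (left⁻ l) (ℕ.<-trans (ℕ.n<1+n x) (right⁻ r)))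
               in y<z , trans (close-sym z y) y<z)
  cover σ)
  where
  left⁻ : ∀ {y} → leftOf x y ≡ true → suc y ℕ.< x
  left⁻ {y} = does-true (suc y ℕ.<? x)
  right⁻ : ∀ {y} → rightOf x y ≡ true → suc x ℕ.< y
  right⁻ {y} = does-true (suc x ℕ.<? y)
  cover : ∀ y → close y x ≡ false → rightOf x y ≡ not (leftOf x y)
  cover y c with ¬close⇒far y x (does-false (close? y x) c)
  ... | inj₁ y<x = trans
    (dec-false (suc x ℕ.<? y) (λ x<y → ℕ.<-asym (ℕ.<-trans (ℕ.n<1+n x) x<y) (ℕ.<-trans (ℕ.n<1+n y) y<x)))
    (cong not (sym (dec-true (suc y ℕ.<? x) y<x)))
  ... | inj₂ x<y = trans
    (dec-true (suc x ℕ.<? y) x<y)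
    (cong not (sym (dec-false (suc y ℕ.<? x)
      (λ y<x → ℕ.<-asym (ℕ.<-trans (ℕ.n<1+n x) x<y) (ℕ.<-trans (ℕ.n<1+n y) y<x)))))

-- Segments and sums over the position of the first arrival

segment : ℕ → ℕ → List ℕ
segment a zero    = []
segment a (suc n) = a ∷ segment (suc a) n

length-segment : ∀ a n → length (segment a n) ≡ n
length-segment a zero    = refl
length-segment a (suc n) = cong suc (length-segment (suc a) n)

segment-≥ : ∀ a n → All (a ℕ.≤_) (segment a n)
segment-≥ a zero    = []
segment-≥ a (suc n) = ℕ.≤-refl ∷ All.map (ℕ.≤-trans (ℕ.n≤1+n a)) (segment-≥ (suc a) n)

segment-< : ∀ a n → All (ℕ._< n ℕ.+ a) (segment a n)
segment-< a zero    = []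
segment-< a (suc n) = ℕ.s≤s (ℕ.m≤n+m a n) ∷
  subst (λ k → All (ℕ._< k) (segment (suc a) n)) (ℕ.+-suc n a) (segment-< (suc a) n)

segment-∷ʳ : ∀ a n → segment a (suc n) ≡ segment a n ++ (n ℕ.+ a ∷ [])
segment-∷ʳ a zero    = refl
segment-∷ʳ a (suc n) = cong (a ∷_) (trans (segment-∷ʳ (suc a) n)
  (cong (λ k → segment (suc a) n ++ (k ∷ [])) (ℕ.+-suc n a)))

map-toℕ-allFin : ∀ n → map toℕ (allFin n) ≡ segment 0 n
map-toℕ-allFin n = go n 0 id (λ _ → refl)
  where
  go : ∀ {m} n a (f : Fin n → Fin m) → (∀ i → toℕ (f i) ≡ a ℕ.+ toℕ i) →
       map toℕ (tabulate f) ≡ segment a n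
  go zero    a f eq = refl
  go (suc n) a f eq = cong₂ _∷_ (trans (eq Fin.zero) (ℕ.+-identityʳ a))
    (go n (suc a) (f ∘ Fin.suc) (λ i → trans (eq (Fin.suc i)) (ℕ.+-suc a (toℕ i))))

sumBelow : (ℕ → ℚ) → ℕ → ℚ
sumBelow v zero    = 0ℚ
sumBelow v (suc n) = sumBelow v n + v n

sumBelow-suc : ∀ v n → sumBelow v (suc n) ≡ v 0 + sumBelow (v ∘ suc) n
sumBelow-suc v zero    = ℚ.+-comm 0ℚ (v 0)
sumBelow-suc v (suc n) = trans (cong (_+ v (suc n)) (sumBelow-suc v n))
  (ℚ.+-assoc (v 0) (sumBelow (v ∘ suc) n) (v (suc n)))

-- The indices satisfy i + j = n - 1: they are the numbers of vertices on either side of the first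
-- arrival in a segment of size n.
sumAntidiagonal : (ℕ → ℕ → ℚ) → ℕ → ℚ
sumAntidiagonal G zero    = 0ℚ
sumAntidiagonal G (suc n) = G 0 n + sumAntidiagonal (λ i j → G (suc i) j) n

sumAntidiagonal-separate : ∀ v w n → sumAntidiagonal (λ i j → 1ℚ + (v i + w j)) n ≡
                           ι n + (sumBelow v n + sumBelow w n)
sumAntidiagonal-separate v w zero    = refl
sumAntidiagonal-separate v w (suc n) = begin
  1ℚ + (v 0 + w n) + sumAntidiagonal (λ i j → 1ℚ + (v (suc i) + w j)) n
    ≡⟨ cong (λ h → 1ℚ + (v 0 + w n) + h) (sumAntidiagonal-separate (v ∘ suc) w n) ⟩
  1ℚ + (v 0 + w n) + (ι n + (sumBelow (v ∘ suc) n + sumBelow w n))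
    ≡⟨ solve 5 (λ a b n s t → con 1ℚ :+ (a :+ b) :+ (n :+ (s :+ t)) := (con 1ℚ :+ n) :+ ((a :+ s) :+ (t :+ b)))
         refl (v 0) (w n) (ι n) (sumBelow (v ∘ suc) n) (sumBelow w n) ⟩
  (1ℚ + ι n) + ((v 0 + sumBelow (v ∘ suc) n) + sumBelow w (suc n))
    ≡⟨ cong₂ (λ h k → h + (k + sumBelow w (suc n))) (ι-+ 1 n) (sumBelow-suc v n) ⟨
  ι (suc n) + (sumBelow v (suc n) + sumBelow w (suc n)) ∎
  where open ≡-Reasoning

sumSplits-segment : ∀ F G a n →
  (∀ i j → suc (i ℕ.+ j) ≡ n → F (i ℕ.+ a) (segment a i ++ segment (suc (i ℕ.+ a)) j) ≡ G i j) →
  sumSplits F (segment a n) ≡ sumAntidiagonal G n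
sumSplits-segment F G a zero    F≡G = refl
sumSplits-segment F G a (suc n) F≡G = cong₂ _+_ (F≡G 0 n refl)
  (sumSplits-segment (λ y ys → F y (a ∷ ys)) (λ i j → G (suc i) j) (suc a) n λ i j i+j≡n →
    subst (λ x → F x (a ∷ segment (suc a) i ++ segment (suc x) j) ≡ G (suc i) j)
      (sym (ℕ.+-suc i a)) (F≡G (suc i) j (cong suc i+j≡n)))

All-≥⇒¬leftOf : ∀ {x} ys → All (λ y → x ℕ.≤ suc y) ys → All (λ y → leftOf x y ≡ false) ys
All-≥⇒¬leftOf {x} ys = All.map λ {y} x≤ → dec-false (suc y ℕ.<? x) (ℕ.≤⇒≯ x≤)

All-≤⇒¬rightOf : ∀ {x} ys → All (ℕ._≤ suc x) ys → All (λ y → rightOf x y ≡ false) ys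
All-≤⇒¬rightOf {x} ys = All.map λ {y} y≤ → dec-false (suc x ℕ.<? y) (ℕ.≤⇒≯ y≤)

meanGreedy : List ℕ → ℚ
meanGreedy = mean (ι ∘ greedySize)

-- Of the `i` vertices on the left, the last one is a neighbour of the first arrival and dies;
-- truncated subtraction also covers a first arrival at the left end.
mean-leftOf : ∀ a i j → let x = i ℕ.+ a in
  mean (ι ∘ greedySize ∘ filterᵇ (leftOf x)) (segment a i ++ segment (suc x) j) ≡
  meanGreedy (segment a (i ∸ 1))
mean-leftOf a zero    j = mean-filter (ι ∘ greedySize) (leftOf a) (segment (suc a) j) []
  (↭.↭-sym (↭.++-identityʳ (segment (suc a) j)))
  (All-≥⇒¬leftOf _ (All.map (λ a<y → ℕ.m≤n⇒m≤1+n (ℕ.<⇒≤ a<y)) (segment-≥ (suc a) j)))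
  []
mean-leftOf a (suc i) j = mean-filter (ι ∘ greedySize) (leftOf (suc i ℕ.+ a))
  ((i ℕ.+ a) ∷ segment (suc (suc i ℕ.+ a)) j) (segment a i)
  (↭.trans (↭.↭-reflexive (trans (cong (_++ segment (suc (suc i ℕ.+ a)) j) (segment-∷ʳ a i))
                                   (++-assoc (segment a i) _ _)))
           (↭.++-comm (segment a i) _))
  (All-≥⇒¬leftOf _ (ℕ.≤-refl ∷ All.map (λ x<y → ℕ.m≤n⇒m≤1+n (ℕ.<⇒≤ x<y)) (segment-≥ (suc (suc i ℕ.+ a)) j)))
  (All.map (λ {y} y<i → dec-true (suc y ℕ.<? suc (i ℕ.+ a)) (ℕ.s≤s y<i)) (segment-< a i))

mean-rightOf : ∀ a i j → let x = i ℕ.+ a in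
  mean (ι ∘ greedySize ∘ filterᵇ (rightOf x)) (segment a i ++ segment (suc x) j) ≡
  meanGreedy (segment (suc (suc x)) (j ∸ 1))
mean-rightOf a i zero    = mean-filter (ι ∘ greedySize) (rightOf (i ℕ.+ a)) (segment a i ++ []) []
  (↭.↭-sym (↭.++-identityʳ _))
  (subst (All _) (sym (++-identityʳ (segment a i)))
    (All-≤⇒¬rightOf _ (All.map (λ y<x → ℕ.m≤n⇒m≤1+n (ℕ.<⇒≤ y<x)) (segment-< a i))))
  []
mean-rightOf a i (suc j) = mean-filter (ι ∘ greedySize) (rightOf x) (segment a i ++ (suc x ∷ []))
  (segment (suc (suc x)) j)
  (↭.↭-reflexive (sym (++-assoc (segment a i) (suc x ∷ []) _)))
  (All-≤⇒¬rightOf _ (All.++⁺ (All.map (λ y<x → ℕ.m≤n⇒m≤1+n (ℕ.<⇒≤ y<x)) (segment-< a i)) (ℕ.≤-refl ∷ [])))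
  (All.map (λ {y} x<y → dec-true (suc x ℕ.<? y) x<y) (segment-≥ (suc (suc x)) j))
  where x = i ℕ.+ a

-- The factor `suc k` turns 1 / (k + 1)! into 1 / k!, so every first arrival contributes a full mean
-- over the orders of the other k vertices. Both sides have size at most k, which is why `E` is
-- prescribed only up to there, ready for strong induction.
meanGreedy-rec : ∀ (E : ℕ → ℚ) k a →
  (∀ m b → m ℕ.≤ k → meanGreedy (segment b m) ≡ E m) →
  ι (suc k) * meanGreedy (segment a (suc k)) ≡
  ι (suc k) + (sumBelow (λ i → E (i ∸ 1)) (suc k) + sumBelow (λ i → E (i ∸ 1)) (suc k))
meanGreedy-rec E k a IH = begin
  ι (suc k) * (invFact (length xs) * sumPerms (ι ∘ greedySize) xs)
    ≡⟨ ℚ.*-assoc (ι (suc k)) _ _ ⟨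
  ι (suc k) * invFact (length xs) * sumPerms (ι ∘ greedySize) xs
    ≡⟨ cong (λ n → ι (suc k) * invFact n * sumPerms (ι ∘ greedySize) xs) (length-segment a (suc k)) ⟩
  ι (suc k) * invFact (suc k) * sumPerms (ι ∘ greedySize) xs
    ≡⟨ cong₂ _*_ (ι*invFact k) (sumPerms-first (ι ∘ greedySize) a (segment (suc a) k)) ⟩
  invFact k * sumSplits (λ y ys → sumPerms (ι ∘ greedySize ∘ (y ∷_)) ys) xs
    ≡⟨ sumSplits-* (invFact k) (λ y ys → sumPerms (ι ∘ greedySize ∘ (y ∷_)) ys) xs ⟨
  sumSplits (λ y ys → invFact k * sumPerms (ι ∘ greedySize ∘ (y ∷_)) ys) xs
    ≡⟨ sumSplits-segment (λ y ys → invFact k * sumPerms (ι ∘ greedySize ∘ (y ∷_)) ys) (λ i j → 1ℚ + (E (i ∸ 1) + E (j ∸ 1))) a (suc k) step ⟩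
  sumAntidiagonal (λ i j → 1ℚ + (E (i ∸ 1) + E (j ∸ 1))) (suc k)
    ≡⟨ sumAntidiagonal-separate (λ i → E (i ∸ 1)) (λ i → E (i ∸ 1)) (suc k) ⟩
  ι (suc k) + (sumBelow (λ i → E (i ∸ 1)) (suc k) + sumBelow (λ i → E (i ∸ 1)) (suc k)) ∎
  where
  open ≡-Reasoning
  xs = segment a (suc k)
  step : ∀ i j → suc (i ℕ.+ j) ≡ suc k →
    invFact k * sumPerms (ι ∘ greedySize ∘ (i ℕ.+ a ∷_)) (segment a i ++ segment (suc (i ℕ.+ a)) j) ≡
    1ℚ + (E (i ∸ 1) + E (j ∸ 1))
  step i j refl = begin
    invFact (i ℕ.+ j) * sumPerms (ι ∘ greedySize ∘ (x ∷_)) ys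
      ≡⟨ cong (λ n → invFact n * sumPerms (ι ∘ greedySize ∘ (x ∷_)) ys) length-ys ⟨
    mean (ι ∘ greedySize ∘ (x ∷_)) ys
      ≡⟨ mean-cong ys (λ σ _ → trans (cong ι (greedySize-∷ x σ)) (trans (ι-+ 1 (L σ ℕ.+ R σ))
           (cong (λ h → 1ℚ + h) (ι-+ (L σ) (R σ))))) ⟩
    mean (λ σ → 1ℚ + (ι (L σ) + ι (R σ))) ys
      ≡⟨ mean-+ (const 1ℚ) (λ σ → ι (L σ) + ι (R σ)) ys ⟩
    mean (const 1ℚ) ys + mean (λ σ → ι (L σ) + ι (R σ)) ys
      ≡⟨ cong₂ _+_ (mean-const 1ℚ ys) (mean-+ (ι ∘ L) (ι ∘ R) ys) ⟩
    1ℚ + (mean (ι ∘ L) ys + mean (ι ∘ R) ys)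
      ≡⟨ cong₂ (λ h k → 1ℚ + (h + k))
           (trans (mean-leftOf a i j) (IH _ _ (ℕ.≤-trans (ℕ.m∸n≤m i 1) (ℕ.m≤m+n i j))))
           (trans (mean-rightOf a i j) (IH _ _ (ℕ.≤-trans (ℕ.m∸n≤m j 1) (ℕ.m≤n+m j i)))) ⟩
    1ℚ + (E (i ∸ 1) + E (j ∸ 1)) ∎
    where
    x  = i ℕ.+ a
    ys = segment a i ++ segment (suc x) j
    L R : List ℕ → ℕ
    L = greedySize ∘ filterᵇ (leftOf x)
    R = greedySize ∘ filterᵇ (rightOf x)
    length-ys : length ys ≡ i ℕ.+ j
    length-ys = trans (length-++ (segment a i)) (cong₂ ℕ._+_ (length-segment a i) (length-segment (suc x) j))

ι-cancel : ∀ k {p q} → ι (suc k) * p ≡ ι (suc k) * q → p ≡ q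
ι-cancel k {p} {q} eq = trans (sym (undo p)) (trans (cong ((+ 1 / suc k) *_) eq) (undo q))
  where
  undo : ∀ p → (+ 1 / suc k) * (ι (suc k) * p) ≡ p
  undo p = trans (sym (ℚ.*-assoc (+ 1 / suc k) (ι (suc k)) p))
    (trans (cong (_* p) (trans (ℚ.*-comm (+ 1 / suc k) (ι (suc k))) (ι*recip (suc k)))) (ℚ.*-identityˡ p))

-- The closed form and its recursion

q₀ : ℚ
q₀ = - (+ 2 / 1)

S t : ℕ → ℚ
S = expSum q₀
t = expTerm q₀

2ℚ : ℚ
2ℚ = 1ℚ + 1ℚ

-- The ratio of consecutive terms without division. Together with a few values at small indices, it
-- is all that is used about the series.
ι*expTerm : ∀ q k → ι (suc k) * expTerm q (suc k) ≡ q * expTerm q k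
ι*expTerm q k = begin
  s * (q * p * r′)    ≡⟨ solve 4 (λ s q p r′ → s :* (q :* p :* r′) := q :* (p :* (s :* r′))) refl s q p r′ ⟩
  q * (p * (s * r′))  ≡⟨ cong (λ h → q * (p * h)) (ι*invFact k) ⟩
  q * expTerm q k     ∎
  where
  open ≡-Reasoning
  s  = ι (suc k)
  p  = q ^ k
  r′ = invFact (suc k)

-- dₖ = Eₖ − Eₖ₋₁ satisfies k dₖ = 1 + 2 Eₖ₋₂ − Eₖ₋₁, so Eₙ = (n + 2) dₙ₊₂ + dₙ₊₁ − 1 with dₖ = (1 − S (k + 1)) / 2.
expectedGreedy : ℕ → ℚ
expectedGreedy n = ½ * (ι (2 ℕ.+ n) * (1ℚ - S (3 ℕ.+ n)) + (1ℚ - S (2 ℕ.+ n)) - 2ℚ)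

-- Here s = S (n + 2) and u, v, w = t (n + 2), t (n + 3), t (n + 4), where x = n.
expectedGreedy-step : ∀ x s u v w → (1ℚ + (2ℚ + x)) * v ≡ q₀ * u → (1ℚ + (1ℚ + (2ℚ + x))) * w ≡ q₀ * v →
  (2ℚ + x) * (½ * ((1ℚ + (1ℚ + (2ℚ + x))) * (1ℚ - (s + u + v + w)) + (1ℚ - (s + u + v)) - 2ℚ)) ≡
  (1ℚ + x) * (½ * ((1ℚ + (2ℚ + x)) * (1ℚ - (s + u + v)) + (1ℚ - (s + u)) - 2ℚ)) + 1ℚ
  + 2ℚ * (½ * ((2ℚ + x) * (1ℚ - (s + u)) + (1ℚ - s) - 2ℚ))
expectedGreedy-step x s u v w hv hw = begin
  lhs
    -- Multiples of the vanishing differences from `hw` and `hv` are added, leaving a polynomial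
    -- identity for the solver: the first multiple eliminates `w`, the second adjusts the
    -- coefficients of `u` and `v`.
    ≡⟨ solve 2 (λ l x → l := l :+ con ½ :* (con 2ℚ :+ x) :* con 0ℚ :+ con ½ :* con 0ℚ) refl lhs x ⟩
  lhs + ½ * (2ℚ + x) * 0ℚ + ½ * 0ℚ
    ≡⟨ cong₂ (λ h k → lhs + ½ * (2ℚ + x) * h + ½ * k) (p≡q⇒0≡p-q hw) (p≡q⇒0≡p-q hv) ⟩
  lhs + ½ * (2ℚ + x) * ((1ℚ + (1ℚ + (2ℚ + x))) * w - q₀ * v) + ½ * ((1ℚ + (2ℚ + x)) * v - q₀ * u)
    ≡⟨ solve 5 (λ x s u v w →
         let two = con 2ℚ; one = con 1ℚ; half = con ½; c₂ = two :+ x; c₃ = one :+ c₂; c₄ = one :+ c₃ in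
         c₂ :* (half :* (c₄ :* (one :- (s :+ u :+ v :+ w)) :+ (one :- (s :+ u :+ v)) :- two))
           :+ half :* c₂ :* (c₄ :* w :- con q₀ :* v) :+ half :* (c₃ :* v :- con q₀ :* u)
         := (one :+ x) :* (half :* (c₃ :* (one :- (s :+ u :+ v)) :+ (one :- (s :+ u)) :- two)) :+ one
            :+ two :* (half :* (c₂ :* (one :- (s :+ u)) :+ (one :- s) :- two)))
         refl x s u v w ⟩
  (1ℚ + x) * (½ * ((1ℚ + (2ℚ + x)) * (1ℚ - (s + u + v)) + (1ℚ - (s + u)) - 2ℚ)) + 1ℚ
  + 2ℚ * (½ * ((2ℚ + x) * (1ℚ - (s + u)) + (1ℚ - s) - 2ℚ)) ∎
  where
  open ≡-Reasoning
  lhs = (2ℚ + x) * (½ * ((1ℚ + (1ℚ + (2ℚ + x))) * (1ℚ - (s + u + v + w)) + (1ℚ - (s + u + v)) - 2ℚ))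
  p≡q⇒0≡p-q : ∀ {p q} → p ≡ q → 0ℚ ≡ p - q
  p≡q⇒0≡p-q {p} refl = sym (ℚ.+-inverseʳ p)

ι₂ : ∀ n → ι (2 ℕ.+ n) ≡ 2ℚ + ι n
ι₂ = ι-+ 2

-- Subtracting consecutive instances removes the sum over the whole history and leaves (n + 2) E(n +
-- 2) = (n + 1) E(n + 1) + 1 + 2 E(n), which is `expectedGreedy-step`.
expectedGreedy-rec : ∀ n → ι (suc n) * expectedGreedy (suc n) ≡
                     ι (suc n) + (sumBelow expectedGreedy n + sumBelow expectedGreedy n)
expectedGreedy-rec zero    = refl
expectedGreedy-rec (suc n) = begin
  ι (2 ℕ.+ n) * expectedGreedy (2 ℕ.+ n)
    ≡⟨ cong₂ (λ a b → a * (½ * (b * (1ℚ - S (5 ℕ.+ n)) + (1ℚ - S (4 ℕ.+ n)) - 2ℚ))) (ι₂ n) ι₄ ⟩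
  (2ℚ + ι n) * (½ * ((1ℚ + (1ℚ + (2ℚ + ι n))) * (1ℚ - S (5 ℕ.+ n)) + (1ℚ - S (4 ℕ.+ n)) - 2ℚ))
    ≡⟨ expectedGreedy-step (ι n) (S (2 ℕ.+ n)) (t (2 ℕ.+ n)) (t (3 ℕ.+ n)) (t (4 ℕ.+ n))
         (trans (cong (_* t (3 ℕ.+ n)) (sym ι₃)) (ι*expTerm q₀ (2 ℕ.+ n)))
         (trans (cong (_* t (4 ℕ.+ n)) (sym ι₄)) (ι*expTerm q₀ (3 ℕ.+ n))) ⟩
  (1ℚ + ι n) * (½ * ((1ℚ + (2ℚ + ι n)) * (1ℚ - S (4 ℕ.+ n)) + (1ℚ - S (3 ℕ.+ n)) - 2ℚ)) + 1ℚ
  + 2ℚ * (½ * ((2ℚ + ι n) * (1ℚ - S (3 ℕ.+ n)) + (1ℚ - S (2 ℕ.+ n)) - 2ℚ))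
    ≡⟨ cong₂ (λ a b → a + 1ℚ + 2ℚ * b)
         (cong₂ (λ a b → a * (½ * (b * (1ℚ - S (4 ℕ.+ n)) + (1ℚ - S (3 ℕ.+ n)) - 2ℚ))) (ι-+ 1 n) ι₃)
         (cong (λ a → ½ * (a * (1ℚ - S (3 ℕ.+ n)) + (1ℚ - S (2 ℕ.+ n)) - 2ℚ)) (ι₂ n)) ⟨
  ι (suc n) * expectedGreedy (suc n) + 1ℚ + 2ℚ * e
    ≡⟨ cong (λ h → h + 1ℚ + 2ℚ * e) (expectedGreedy-rec n) ⟩
  ι (suc n) + (T + T) + 1ℚ + 2ℚ * e
    ≡⟨ solve 3 (λ m T e → m :+ (T :+ T) :+ con 1ℚ :+ con 2ℚ :* e := (con 1ℚ :+ m) :+ ((T :+ e) :+ (T :+ e)))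
         refl (ι (suc n)) T e ⟩
  (1ℚ + ι (suc n)) + ((T + e) + (T + e))
    ≡⟨ cong (_+ ((T + e) + (T + e))) (ι-+ 1 (suc n)) ⟨
  ι (2 ℕ.+ n) + ((T + e) + (T + e)) ∎
  where
  open ≡-Reasoning
  e = expectedGreedy n
  T = sumBelow expectedGreedy n
  ι₃ : ι (3 ℕ.+ n) ≡ 1ℚ + (2ℚ + ι n)
  ι₃ = trans (ι-+ 1 (2 ℕ.+ n)) (cong (λ h → 1ℚ + h) (ι₂ n))
  ι₄ : ι (4 ℕ.+ n) ≡ 1ℚ + (1ℚ + (2ℚ + ι n))
  ι₄ = trans (ι-+ 1 (3 ℕ.+ n)) (cong (λ h → 1ℚ + h) ι₃)

-- The indices 0 and 1 both give `expectedGreedy 0`, which evaluates to 0, so the truncated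
-- subtraction adds only a zero summand.
sumBelow-pred : ∀ k → sumBelow (λ i → expectedGreedy (i ∸ 1)) (suc k) ≡ sumBelow expectedGreedy k
sumBelow-pred zero    = refl
sumBelow-pred (suc k) = cong (_+ expectedGreedy k) (sumBelow-pred k)

meanGreedy-segment : ∀ n a → meanGreedy (segment a n) ≡ expectedGreedy n
meanGreedy-segment n = go n n ℕ.≤-refl
  where
  -- `bound` makes the induction strong, since a side of the first arrival can be shorter by any
  -- amount; the start `a` varies for the right-hand sides.
  go : ∀ bound n → n ℕ.≤ bound → ∀ a → meanGreedy (segment a n) ≡ expectedGreedy n
  go _           zero    _              a = refl
  go (suc bound) (suc k) (ℕ.s≤s k≤bound) a = ι-cancel k (begin
    ι (suc k) * meanGreedy (segment a (suc k))
      ≡⟨ meanGreedy-rec expectedGreedy k a (λ m b m≤k → go bound m (ℕ.≤-trans m≤k k≤bound) b) ⟩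
    ι (suc k) + (sumBelow _ (suc k) + sumBelow _ (suc k))
      ≡⟨ cong (λ h → ι (suc k) + (h + h)) (sumBelow-pred k) ⟩
    ι (suc k) + (sumBelow expectedGreedy k + sumBelow expectedGreedy k)
      ≡⟨ expectedGreedy-rec k ⟨
    ι (suc k) * expectedGreedy (suc k) ∎)
    where open ≡-Reasoning

𝔼-ALG : ∀ n (C : SimpleChain n) → 𝔼 n (ALG C) ≡ expectedGreedy n
𝔼-ALG n C = begin
  𝔼 n (ALG C)
    ≡⟨ /-as-* (sum (map (ALG C) (permutations (allFin n)))) (n !) {{n ℕ.!≢0}} ⟩
  ι (sum (map (ALG C) (permutations (allFin n)))) * invFact n
    ≡⟨ cong (_* invFact n) (sum-permutations (ALG C) (allFin n)) ⟩
  sumPerms (ι ∘ ALG C) (allFin n) * invFact n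
    ≡⟨ cong (_* invFact n) (sumPerms-cong (allFin n)
         (λ σ _ → cong ι (length-greedy C [] (const false) (λ _ → refl) σ))) ⟩
  sumPerms (ι ∘ greedySize ∘ map toℕ) (allFin n) * invFact n
    ≡⟨ cong (_* invFact n) (sumPerms-map toℕ (ι ∘ greedySize) (allFin n)) ⟩
  sumPerms (ι ∘ greedySize) (map toℕ (allFin n)) * invFact n
    ≡⟨ cong (λ xs → sumPerms (ι ∘ greedySize) xs * invFact n) (map-toℕ-allFin n) ⟩
  sumPerms (ι ∘ greedySize) (segment 0 n) * invFact n
    ≡⟨ ℚ.*-comm _ (invFact n) ⟩
  invFact n * sumPerms (ι ∘ greedySize) (segment 0 n)
    ≡⟨ cong (λ k → invFact k * sumPerms (ι ∘ greedySize) (segment 0 n)) (length-segment 0 n) ⟨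
  meanGreedy (segment 0 n)
    ≡⟨ meanGreedy-segment n 0 ⟩
  expectedGreedy n ∎
  where open ≡-Reasoning

-- The optimum, and a chain of every size

NonAdjacent : ∀ {n} → Subset n → Set
NonAdjacent S = ∀ i j → i ∈ S → j ∈ S → toℕ j ≢ suc (toℕ i)

nonAdjacent-tail : ∀ {n b} {S : Subset n} → NonAdjacent (b ∷ S) → NonAdjacent S
nonAdjacent-tail na i j i∈ j∈ eq = na (Fin.suc i) (Fin.suc j) (there i∈) (there j∈) (cong suc eq)

-- A chosen vertex forces its successor out, so it uses up two places except at the right end.
∣nonAdjacent∣≤ : ∀ {n} (S : Subset n) → NonAdjacent S → ∣ S ∣ ℕ.≤ ℕ.⌈ n /2⌉
∣nonAdjacent∣≤ []                    na = ℕ.z≤n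
∣nonAdjacent∣≤ (outside ∷ S)         na = ℕ.≤-trans (∣nonAdjacent∣≤ S (nonAdjacent-tail na)) (ℕ.⌈n/2⌉-mono (ℕ.n≤1+n _))
∣nonAdjacent∣≤ (inside ∷ [])         na = ℕ.s≤s ℕ.z≤n
∣nonAdjacent∣≤ (inside ∷ inside ∷ S) na = ⊥-elim (na Fin.zero (Fin.suc Fin.zero) here (there here) refl)
∣nonAdjacent∣≤ (inside ∷ outside ∷ S) na = ℕ.s≤s (∣nonAdjacent∣≤ S (nonAdjacent-tail (nonAdjacent-tail na)))

alternating : ∀ n → Subset n
alternating 0             = []
alternating 1             = inside ∷ []
alternating (suc (suc n)) = inside ∷ outside ∷ alternating n

∣alternating∣ : ∀ n → ∣ alternating n ∣ ≡ ℕ.⌈ n /2⌉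
∣alternating∣ 0             = refl
∣alternating∣ 1             = refl
∣alternating∣ (suc (suc n)) = cong suc (∣alternating∣ n)

alternating-nonAdjacent : ∀ n → NonAdjacent (alternating n)
alternating-nonAdjacent 1 Fin.zero Fin.zero _ _ ()
alternating-nonAdjacent (suc (suc n)) Fin.zero (Fin.suc Fin.zero) _ (there ()) _
alternating-nonAdjacent (suc (suc n)) (Fin.suc (Fin.suc i)) (Fin.suc (Fin.suc j))
  (there (there i∈)) (there (there j∈)) eq =
  alternating-nonAdjacent n i j i∈ j∈ (ℕ.suc-injective (ℕ.suc-injective eq))

∈-subsets : ∀ {n} (S : Subset n) → S List.∈ subsets n
∈-subsets []                        = Any.here refl
∈-subsets {suc n} (inside ∷ S)      = List.∈-++⁺ˡ (List.∈-map⁺ (inside ∷_) (∈-subsets S))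
∈-subsets {suc n} (outside ∷ S)     = List.∈-++⁺ʳ (map (inside ∷_) (subsets n)) (List.∈-map⁺ (outside ∷_) (∈-subsets S))

∣m-n∣≡1⇒ : ∀ m n → ℕ.∣ m - n ∣ ≡ 1 → n ≡ suc m ⊎ m ≡ suc n
∣m-n∣≡1⇒ zero    n       eq = inj₁ eq
∣m-n∣≡1⇒ (suc m) zero    eq = inj₂ eq
∣m-n∣≡1⇒ (suc m) (suc n) eq with ∣m-n∣≡1⇒ m n eq
... | inj₁ e = inj₁ (cong suc e)
... | inj₂ e = inj₂ (cong suc e)

∣m-n∣≡1⇐ : ∀ m n → m ≢ n → m ℕ.≤ suc n → n ℕ.≤ suc m → ℕ.∣ m - n ∣ ≡ 1
∣m-n∣≡1⇐ zero          zero          m≢n _ _ = ⊥-elim (m≢n refl)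
∣m-n∣≡1⇐ zero          (suc zero)    _ _ _ = refl
∣m-n∣≡1⇐ zero          (suc (suc n)) _ _ (ℕ.s≤s ())
∣m-n∣≡1⇐ (suc zero)    zero          _ _ _ = refl
∣m-n∣≡1⇐ (suc (suc m)) zero          _ (ℕ.s≤s ()) _
∣m-n∣≡1⇐ (suc m)       (suc n)       m≢n (ℕ.s≤s m≤) (ℕ.s≤s n≤) = ∣m-n∣≡1⇐ m n (m≢n ∘ cong suc) m≤ n≤

module _ {n} (C : SimpleChain n) where

  open SimpleChain C

  independent⇒nonAdjacent : ∀ S → Independent C S → NonAdjacent S
  independent⇒nonAdjacent S ind i j i∈ j∈ j≡1+i = ind i j i∈ j∈ i≢j (Equivalence.from (path i≢j)
    (trans (cong (λ k → ℕ.∣ toℕ i - k ∣) j≡1+i) (∣m-n∣≡1⇐ (toℕ i) (suc (toℕ i)) (ℕ.1+n≢n ∘ sym) (ℕ.m≤n⇒m≤1+n (ℕ.n≤1+n _)) ℕ.≤-refl)))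
    where
    i≢j : i ≢ j
    i≢j refl = ℕ.1+n≢n (sym j≡1+i)

  nonAdjacent⇒independent : ∀ S → NonAdjacent S → Independent C S
  nonAdjacent⇒independent S na i j i∈ j∈ i≢j o with ∣m-n∣≡1⇒ (toℕ i) (toℕ j) (Equivalence.to (path i≢j) o)
  ... | inj₁ j≡1+i = na i j i∈ j∈ j≡1+i
  ... | inj₂ i≡1+j = na j i j∈ i∈ i≡1+j

  OPT≡⌈n/2⌉ : OPT C ≡ ℕ.⌈ n /2⌉
  OPT≡⌈n/2⌉ = ℕ.≤-antisym
    (List.max≤v⁺ ℕ.z≤n (All.map⁺ (All.map (λ {S} ind → ∣nonAdjacent∣≤ S (independent⇒nonAdjacent S ind))
      (All.all-filter (independent? C) (subsets n)))))
    (subst (ℕ._≤ OPT C) (∣alternating∣ n) (List.v≤max⁺ 0 _ (inj₂ (List.lose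
      (List.∈-map⁺ ∣_∣ (List.∈-filter⁺ (independent? C) (∈-subsets (alternating n))
        (nonAdjacent⇒independent (alternating n) (alternating-nonAdjacent n))))
      ℕ.≤-refl))))

p≤p+ε : ∀ p {ε} → 0ℚ ≤ ε → p ≤ p + ε
p≤p+ε p 0≤ε = ℚ.≤-trans (ℚ.≤-reflexive (sym (ℚ.+-identityʳ p))) (ℚ.+-monoʳ-≤ p 0≤ε)

pointwise-≤ᵣ : ∀ x y → (∀ k → seq x k ≤ seq y k) → x ≤ᵣ y
pointwise-≤ᵣ x y x≤y ε 0<ε = 0 , λ k _ → ℚ.≤-trans (x≤y k) (p≤p+ε (seq y k) (ℚ.<⇒≤ 0<ε))

-- The order on reals holds only eventually and up to an error. Two errors of ¼ stay below the gap 1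
-- between distinct naturals, and a common late index lets both bounds meet.
≤ᵣ-between-ℕ : ∀ m n x → fromℕ m ≤ᵣ x → x ≤ᵣ fromℕ n → m ℕ.≤ n
≤ᵣ-between-ℕ m n x m≤x x≤n = ℕ.≮⇒≥ λ n<m → ℚ.<-irrefl refl (begin-strict
  ι m                   ≤⟨ proj₂ (m≤x ¼ 0<¼) k (ℕ.m≤m⊔n (proj₁ (m≤x ¼ 0<¼)) (proj₁ (x≤n ¼ 0<¼))) ⟩
  seq x k + ¼           ≤⟨ ℚ.+-monoˡ-≤ ¼ (proj₂ (x≤n ¼ 0<¼) k (ℕ.m≤n⊔m (proj₁ (m≤x ¼ 0<¼)) (proj₁ (x≤n ¼ 0<¼)))) ⟩
  ι n + ¼ + ¼           ≡⟨ solve 1 (λ n → n :+ con ¼ :+ con ¼ := con ½ :+ n) refl (ι n) ⟩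
  ½ + ι n               <⟨ ℚ.+-monoˡ-< (ι n) {½} {1ℚ} (ℚ.*<* (ℤ.+<+ (ℕ.s≤s (ℕ.s≤s ℕ.z≤n)))) ⟩
  1ℚ + ι n              ≡⟨ ι-+ 1 n ⟨
  ι (suc n)             ≤⟨ ι-mono-≤ n<m ⟩
  ι m                   ∎)
  where
  open ℚ.≤-Reasoning
  ¼ : ℚ
  ¼ = + 1 / 4
  0<¼ : 0ℚ < ¼
  0<¼ = ℚ.positive⁻¹ ¼
  k = proj₁ (m≤x ¼ 0<¼) ℕ.⊔ proj₁ (x≤n ¼ 0<¼)

unitInterval : ℕ → Interval
unitInterval m = ⟦ fromℕ m , fromℕ (suc m) ⟧

∈-unitInterval : ∀ m k → m ℕ.≤ k → k ℕ.≤ suc m → fromℕ k ∈ᵢ unitInterval m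
∈-unitInterval m k m≤k k≤1+m =
  pointwise-≤ᵣ (fromℕ m) (fromℕ k) (λ _ → ι-mono-≤ m≤k) ,
  pointwise-≤ᵣ (fromℕ k) (fromℕ (suc m)) (λ _ → ι-mono-≤ k≤1+m)

-- The intervals [m, m + 1] are closed, so neighbours overlap in a single endpoint. Since `𝔼` and
-- `OPT` depend on the size alone, one chain per size is enough for optimality.
touchingChain : ∀ n → SimpleChain n
touchingChain n = record
  { interval   = unitInterval ∘ toℕ
  ; unitLength = λ i →
      pointwise-≤ᵣ (fromℕ (suc (toℕ i))) (fromℕ (toℕ i) +ᵣ 1ᵣ) (λ _ → ℚ.≤-reflexive (ι-suc (toℕ i))) ,
      pointwise-≤ᵣ (fromℕ (toℕ i) +ᵣ 1ᵣ) (fromℕ (suc (toℕ i))) (λ _ → ℚ.≤-reflexive (sym (ι-suc (toℕ i))))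
  ; increasing = λ {i} i<j → 1ℚ , ℚ.positive⁻¹ 1ℚ , 0 , λ _ _ →
      ℚ.≤-trans (ℚ.≤-reflexive (sym (ι-suc (toℕ i)))) (ι-mono-≤ i<j)
  ; path       = λ {i} {j} i≢j → mk⇔
      (λ (x , (i≤x , x≤1+i) , (j≤x , x≤1+j)) → ∣m-n∣≡1⇐ (toℕ i) (toℕ j) (i≢j ∘ Fin.toℕ-injective)
        (≤ᵣ-between-ℕ (toℕ i) (suc (toℕ j)) x i≤x x≤1+j)
        (≤ᵣ-between-ℕ (toℕ j) (suc (toℕ i)) x j≤x x≤1+i))
      (touching (toℕ i) (toℕ j) ∘ ∣m-n∣≡1⇒ (toℕ i) (toℕ j))
  }
  where
  ι-suc : ∀ m → ι (suc m) ≡ ι m + 1ℚ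
  ι-suc m = trans (ι-+ 1 m) (ℚ.+-comm 1ℚ (ι m))
  touching : ∀ k l → l ≡ suc k ⊎ k ≡ suc l → Overlap (unitInterval k) (unitInterval l)
  touching k _ (inj₁ refl) = fromℕ (suc k) ,
    ∈-unitInterval k (suc k) (ℕ.n≤1+n k) ℕ.≤-refl , ∈-unitInterval (suc k) (suc k) ℕ.≤-refl (ℕ.n≤1+n (suc k))
  touching _ l (inj₂ refl) = fromℕ (suc l) ,
    ∈-unitInterval (suc l) (suc l) ℕ.≤-refl (ℕ.n≤1+n (suc l)) , ∈-unitInterval l (suc l) (ℕ.n≤1+n l) ℕ.≤-refl

-- Tails of the exponential series

p≤∣p∣ : ∀ p → p ≤ ℚ.∣ p ∣
p≤∣p∣ p with ℚ.≤-total 0ℚ p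
... | inj₁ 0≤p = ℚ.≤-reflexive (sym (ℚ.0≤p⇒∣p∣≡p 0≤p))
... | inj₂ p≤0 = ℚ.≤-trans p≤0 (ℚ.0≤∣p∣ p)

∣p-q∣≡∣q-p∣ : ∀ p q → ℚ.∣ p - q ∣ ≡ ℚ.∣ q - p ∣
∣p-q∣≡∣q-p∣ p q = trans (sym (ℚ.∣-p∣≡∣p∣ (p - q)))
  (cong ℚ.∣_∣ (solve 2 (λ p q → :- (p :- q) := q :- p) refl p q))

∣p-q∣≤⇒p≤q+ : ∀ p q {B} → ℚ.∣ p - q ∣ ≤ B → p ≤ q + B
∣p-q∣≤⇒p≤q+ p q {B} ∣p-q∣≤B = begin
  p              ≡⟨ solve 2 (λ p q → p := q :+ (p :- q)) refl p q ⟩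
  q + (p - q)    ≤⟨ ℚ.+-monoʳ-≤ q (ℚ.≤-trans (p≤∣p∣ (p - q)) ∣p-q∣≤B) ⟩
  q + B          ∎
  where open ℚ.≤-Reasoning

∣p-q∣≤⇒q≤p+ : ∀ p q {B} → ℚ.∣ p - q ∣ ≤ B → q ≤ p + B
∣p-q∣≤⇒q≤p+ p q {B} ∣p-q∣≤B = ∣p-q∣≤⇒p≤q+ q p (subst (_≤ B) (∣p-q∣≡∣q-p∣ p q) ∣p-q∣≤B)

∣+∣≤ : ∀ p q {P Q} → ℚ.∣ p ∣ ≤ P → ℚ.∣ q ∣ ≤ Q → ℚ.∣ p + q ∣ ≤ P + Q
∣+∣≤ p q p≤ q≤ = ℚ.≤-trans (ℚ.∣p+q∣≤∣p∣+∣q∣ p q) (ℚ.+-mono-≤ p≤ q≤)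

∣*∣≤ : ∀ c p {P} → ℚ.∣ p ∣ ≤ P → ℚ.∣ c * p ∣ ≤ ℚ.∣ c ∣ * P
∣*∣≤ c p {P} p≤ = subst (_≤ ℚ.∣ c ∣ * P) (sym (ℚ.∣p*q∣≡∣p∣*∣q∣ c p))
  (ℚ.*-monoˡ-≤-nonNeg ℚ.∣ c ∣ {{ℚ.∣-∣-nonNeg c}} p≤)

∣ι∣ : ∀ n → ℚ.∣ ι n ∣ ≡ ι n
∣ι∣ n = ℚ.0≤p⇒∣p∣≡p (0≤ι n)

archimedean : ∀ p → ∃[ n ] (p ≤ ι n)
archimedean p@(ℚ.mkℚ i d _) = ℤ.∣ i ∣ , ℚ.toℚᵘ-cancel-≤ (begin
  ℚ.toℚᵘ p               ≤⟨ ℚᵘ.*≤* (bound i) ⟩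
  mkℚᵘ (+ ℤ.∣ i ∣) 0     ≃⟨ ℚ.toℚᵘ-fromℚᵘ (mkℚᵘ (+ ℤ.∣ i ∣) 0) ⟨
  ℚ.toℚᵘ (ι ℤ.∣ i ∣)     ∎)
  where
  open ℚᵘ.≤-Reasoning
  bound : ∀ i → i ℤ.* + 1 ℤ.≤ + ℤ.∣ i ∣ ℤ.* + suc d
  bound (+ n)    = ℤ.*-monoˡ-≤-nonNeg (+ n) (ℤ.+≤+ (ℕ.s≤s ℕ.z≤n))
  bound -[1+ n ] = ℤ.-≤+

archimedean-* : ∀ ε B → 0ℚ < ε → ∃[ n ] (B ≤ ε * ι n)
archimedean-* ε B 0<ε = n , (begin
  B                    ≡⟨ ℚ.*-identityˡ B ⟨
  1ℚ * B               ≡⟨ cong (_* B) (ℚ.*-inverseʳ ε) ⟨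
  ε * 1/ε * B          ≡⟨ ℚ.*-assoc ε 1/ε B ⟩
  ε * (1/ε * B)        ≤⟨ ℚ.*-monoˡ-≤-nonNeg ε {{ℚ.pos⇒nonNeg ε}} (proj₂ (archimedean (1/ε * B))) ⟩
  ε * ι n              ∎)
  where
  open ℚ.≤-Reasoning
  instance
    ε-pos : ℚ.Positive ε
    ε-pos = ℚ.positive 0<ε
    ε≢0 : ℚ.NonZero ε
    ε≢0 = ℚ.pos⇒nonZero ε
  1/ε = ℚ.1/ ε
  n = proj₁ (archimedean (1/ε * B))

∣t∣ : ℕ → ℚ
∣t∣ k = ℚ.∣ t k ∣

ι*∣t∣ : ∀ k → ι (suc k) * ∣t∣ (suc k) ≡ 2ℚ * ∣t∣ k
ι*∣t∣ k = begin
  ι (suc k) * ℚ.∣ t (suc k) ∣          ≡⟨ cong (_* ∣t∣ (suc k)) (∣ι∣ (suc k)) ⟨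
  ℚ.∣ ι (suc k) ∣ * ℚ.∣ t (suc k) ∣    ≡⟨ ℚ.∣p*q∣≡∣p∣*∣q∣ (ι (suc k)) (t (suc k)) ⟨
  ℚ.∣ ι (suc k) * t (suc k) ∣          ≡⟨ cong ℚ.∣_∣ (ι*expTerm q₀ k) ⟩
  ℚ.∣ q₀ * t k ∣                       ≡⟨ ℚ.∣p*q∣≡∣p∣*∣q∣ q₀ (t k) ⟩
  2ℚ * ∣t∣ k                           ∎
  where open ≡-Reasoning

-- The ratio of absolute values is 2 / (k + 1), at most ½ from k = 3 on.
∣t∣-halves : ∀ k → 3 ℕ.≤ k → ∣t∣ (suc k) ≤ ½ * ∣t∣ k
∣t∣-halves k 3≤k = ℚ.*-cancelˡ-≤-pos (ι 4) (begin
  ι 4 * ∣t∣ (suc k)             ≤⟨ ℚ.*-monoʳ-≤-nonNeg (∣t∣ (suc k)) {{ℚ.∣-∣-nonNeg (t (suc k))}} (ι-mono-≤ (ℕ.s≤s 3≤k)) ⟩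
  ι (suc k) * ∣t∣ (suc k)       ≡⟨ ι*∣t∣ k ⟩
  2ℚ * ∣t∣ k                    ≡⟨ solve 1 (λ a → con 2ℚ :* a := con (ι 4) :* (con ½ :* a)) refl (∣t∣ k) ⟩
  ι 4 * (½ * ∣t∣ k)             ∎)
  where open ℚ.≤-Reasoning

∣t∣≤2 : ∀ j → ∣t∣ (3 ℕ.+ j) ≤ 2ℚ
∣t∣≤2 zero    = toWitness {a? = ∣t∣ 3 ℚ.≤? 2ℚ} _
∣t∣≤2 (suc j) = begin
  ∣t∣ (4 ℕ.+ j)          ≤⟨ ∣t∣-halves (3 ℕ.+ j) (ℕ.m≤m+n 3 j) ⟩
  ½ * ∣t∣ (3 ℕ.+ j)      ≤⟨ ℚ.*-monoˡ-≤-nonNeg ½ (∣t∣≤2 j) ⟩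
  1ℚ                     ≤⟨ p≤p+ε 1ℚ (ℚ.<⇒≤ (ℚ.positive⁻¹ 1ℚ)) ⟩
  2ℚ                     ∎
  where open ℚ.≤-Reasoning

-- Geometric tail bound. The extra term on the left keeps the induction going: by halving, |t(e)| +
-- 2 |t(e + 1)| ≤ 2 |t(e)|.
S-tail-+ : ∀ m d → 3 ℕ.≤ m →
           ℚ.∣ S (d ℕ.+ m) - S m ∣ + 2ℚ * ∣t∣ (d ℕ.+ m) ≤ 2ℚ * ∣t∣ m
S-tail-+ m zero    3≤m = ℚ.≤-reflexive (trans
  (cong (λ h → ℚ.∣ h ∣ + 2ℚ * ∣t∣ m) (ℚ.+-inverseʳ (S m))) (ℚ.+-identityˡ (2ℚ * ∣t∣ m)))
S-tail-+ m (suc d) 3≤m = begin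
  ℚ.∣ S e + t e - S m ∣ + 2ℚ * ∣t∣ (suc e)
    ≤⟨ ℚ.+-mono-≤ triangle (ℚ.*-monoˡ-≤-nonNeg 2ℚ (∣t∣-halves e (ℕ.≤-trans 3≤m (ℕ.m≤n+m m d)))) ⟩
  ℚ.∣ S e - S m ∣ + ∣t∣ e + 2ℚ * (½ * ∣t∣ e)
    ≡⟨ solve 2 (λ s a → s :+ a :+ con 2ℚ :* (con ½ :* a) := s :+ con 2ℚ :* a) refl ℚ.∣ S e - S m ∣ (∣t∣ e) ⟩
  ℚ.∣ S e - S m ∣ + 2ℚ * ∣t∣ e
    ≤⟨ S-tail-+ m d 3≤m ⟩
  2ℚ * ∣t∣ m ∎
  where
  open ℚ.≤-Reasoning
  e = d ℕ.+ m
  triangle : ℚ.∣ S e + t e - S m ∣ ≤ ℚ.∣ S e - S m ∣ + ∣t∣ e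
  triangle = subst (λ h → ℚ.∣ h ∣ ≤ ℚ.∣ S e - S m ∣ + ∣t∣ e)
    (solve 3 (λ s t m → (s :- m) :+ t := s :+ t :- m) refl (S e) (t e) (S m))
    (ℚ.∣p+q∣≤∣p∣+∣q∣ (S e - S m) (t e))

S-tail : ∀ {m k} → 3 ℕ.≤ m → m ℕ.≤ k → ℚ.∣ S k - S m ∣ ≤ 2ℚ * ∣t∣ m
S-tail {m} {k} 3≤m m≤k = begin
  ℚ.∣ S k - S m ∣                        ≡⟨ cong (λ k → ℚ.∣ S k - S m ∣) (ℕ.m∸n+n≡m m≤k) ⟨
  ℚ.∣ S k′ - S m ∣                       ≤⟨ p≤p+ε _ (ℚ.nonNegative⁻¹ (2ℚ * ∣t∣ k′) {{ℚ.nonNeg*nonNeg⇒nonNeg 2ℚ (∣t∣ k′) {{ℚ.∣-∣-nonNeg (t k′)}}}}) ⟩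
  ℚ.∣ S k′ - S m ∣ + 2ℚ * ∣t∣ k′         ≤⟨ S-tail-+ m (k ∸ m) 3≤m ⟩
  2ℚ * ∣t∣ m                             ∎
  where
  open ℚ.≤-Reasoning
  k′ = k ∸ m ℕ.+ m

-- The k-th term of the Cauchy sequence that represents 1 - e⁻².
L : ℕ → ℚ
L k = 1ℚ - S k

-- `S 3` evaluates to 1, so this is a tail bound from index 3, with 2 |t(3)| = 8/3.
∣L∣≤3 : ∀ k → 3 ℕ.≤ k → ℚ.∣ L k ∣ ≤ ι 3
∣L∣≤3 k 3≤k = begin
  ℚ.∣ 1ℚ - S k ∣     ≡⟨ ∣p-q∣≡∣q-p∣ 1ℚ (S k) ⟩
  ℚ.∣ S k - 1ℚ ∣     ≤⟨ S-tail {3} {k} ℕ.≤-refl 3≤k ⟩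
  2ℚ * ∣t∣ 3           ≤⟨ toWitness {a? = 2ℚ * ∣t∣ 3 ℚ.≤? ι 3} _ ⟩
  ι 3                ∎
  where open ℚ.≤-Reasoning

-- The dangerous summand is (n + 3) times a tail, at most 2 (n + 3) |t(n + 3)| = 4 |t(n + 2)| ≤ 8;
-- the factor disappears into the factorial. In the order of the decomposition, 25 = 8 + 3 · 3 + 3 +
-- 3 + 2. Positive n gives n + 2 ≥ 3, where the bounds on `t` and `L` start.
expectedGreedy-close : ∀ n k → 1 ℕ.≤ n → 3 ℕ.+ n ℕ.≤ k →
  ℚ.∣ ι n * L k - (expectedGreedy n + expectedGreedy n) ∣ ≤ ι 25
expectedGreedy-close n@(suc j) k 1≤n n+3≤k = begin
  ℚ.∣ ι n * L k - (expectedGreedy n + expectedGreedy n) ∣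
    ≡⟨ cong ℚ.∣_∣ decompose ⟩
  ℚ.∣ ι (3 ℕ.+ n) * (S (3 ℕ.+ n) - S k) + - ι 3 * L k + L (3 ℕ.+ n) + - 1ℚ * L (2 ℕ.+ n) + 2ℚ ∣
    ≤⟨ ∣+∣≤ _ 2ℚ (∣+∣≤ _ (- 1ℚ * L (2 ℕ.+ n)) (∣+∣≤ _ (L (3 ℕ.+ n)) (∣+∣≤ _ (- ι 3 * L k)
         main (∣*∣≤ (- ι 3) (L k) (∣L∣≤3 k (ℕ.≤-trans (ℕ.m≤m+n 3 n) n+3≤k))))
         (∣L∣≤3 (3 ℕ.+ n) (ℕ.m≤m+n 3 n)))
         (∣*∣≤ (- 1ℚ) (L (2 ℕ.+ n)) (∣L∣≤3 (2 ℕ.+ n) (ℕ.m≤m+n 3 j)))) ℚ.≤-refl ⟩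
  ι 25 ∎
  where
  open ℚ.≤-Reasoning
  main : ℚ.∣ ι (3 ℕ.+ n) * (S (3 ℕ.+ n) - S k) ∣ ≤ ι 8
  main = begin
    ℚ.∣ ι (3 ℕ.+ n) * (S (3 ℕ.+ n) - S k) ∣
      ≤⟨ ∣*∣≤ (ι (3 ℕ.+ n)) (S (3 ℕ.+ n) - S k)
           (subst (_≤ 2ℚ * ∣t∣ (3 ℕ.+ n)) (∣p-q∣≡∣q-p∣ (S k) (S (3 ℕ.+ n)))
             (S-tail (ℕ.m≤m+n 3 n) n+3≤k)) ⟩
    ℚ.∣ ι (3 ℕ.+ n) ∣ * (2ℚ * ∣t∣ (3 ℕ.+ n))
      ≡⟨ cong (_* (2ℚ * ∣t∣ (3 ℕ.+ n))) (∣ι∣ (3 ℕ.+ n)) ⟩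
    ι (3 ℕ.+ n) * (2ℚ * ∣t∣ (3 ℕ.+ n))
      ≡⟨ solve 2 (λ x a → x :* (con 2ℚ :* a) := con 2ℚ :* (x :* a)) refl (ι (3 ℕ.+ n)) (∣t∣ (3 ℕ.+ n)) ⟩
    2ℚ * (ι (3 ℕ.+ n) * ∣t∣ (3 ℕ.+ n))
      ≡⟨ cong (2ℚ *_) (ι*∣t∣ (2 ℕ.+ n)) ⟩
    2ℚ * (2ℚ * ∣t∣ (2 ℕ.+ n))
      ≤⟨ ℚ.*-monoˡ-≤-nonNeg 2ℚ (ℚ.*-monoˡ-≤-nonNeg 2ℚ (∣t∣≤2 j)) ⟩
    ι 8 ∎
  decompose : ι n * L k - (expectedGreedy n + expectedGreedy n) ≡
    ι (3 ℕ.+ n) * (S (3 ℕ.+ n) - S k) + - ι 3 * L k + L (3 ℕ.+ n) + - 1ℚ * L (2 ℕ.+ n) + 2ℚ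
  decompose rewrite ι-+ 3 n | ι-+ 2 n = solve 4 (λ x s₂ s₃ s →
    let one = con 1ℚ; half = con ½; two = con 2ℚ; e = half :* ((two :+ x) :* (one :- s₃) :+ (one :- s₂) :- two) in
    x :* (one :- s) :- (e :+ e) :=
    (con (ι 3) :+ x) :* (s₃ :- s) :+ con (- ι 3) :* (one :- s) :+ (one :- s₃) :+ con (- 1ℚ) :* (one :- s₂) :+ two)
    refl (ι n) (S (2 ℕ.+ n)) (S (3 ℕ.+ n)) (S k)

-- Comparison with the optimum

⌈n/2⌉-doubled : ∀ n → ℕ.⌈ n /2⌉ ℕ.+ ℕ.⌈ n /2⌉ ≡ n ⊎ ℕ.⌈ n /2⌉ ℕ.+ ℕ.⌈ n /2⌉ ≡ suc n
⌈n/2⌉-doubled 0             = inj₁ refl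
⌈n/2⌉-doubled 1             = inj₂ refl
⌈n/2⌉-doubled (suc (suc n)) with ⌈n/2⌉-doubled n
... | inj₁ eq = inj₁ (cong suc (trans (ℕ.+-suc _ _) (cong suc eq)))
... | inj₂ eq = inj₂ (cong suc (trans (ℕ.+-suc _ _) (cong suc eq)))

½-mono : ∀ {p q} → p + p ≤ q + q → p ≤ q
½-mono {p} {q} 2p≤2q = subst₂ _≤_ (half p) (half q) (ℚ.*-monoˡ-≤-nonNeg ½ 2p≤2q)
  where
  half : ∀ p → ½ * (p + p) ≡ p
  half = solve 1 (λ p → con ½ :* (p :+ p) := p) refl

-- For odd n the doubled optimum is n + 1, which costs one more `L k`, at most 3; hence 14 = (25 +
-- 3) / 2.
L*⌈n/2⌉≤ : ∀ n k → 1 ℕ.≤ n → 3 ℕ.+ n ℕ.≤ k → L k * ι ℕ.⌈ n /2⌉ ≤ expectedGreedy n + ι 14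
L*⌈n/2⌉≤ n k 1≤n n+3≤k = ½-mono (begin
  L k * ι h + L k * ι h        ≡⟨ ℚ.*-distribˡ-+ (L k) (ι h) (ι h) ⟨
  L k * (ι h + ι h)            ≡⟨ cong (L k *_) (ι-+ h h) ⟨
  L k * ι (h ℕ.+ h)            ≤⟨ doubled (⌈n/2⌉-doubled n) ⟩
  ι n * L k + ι 3              ≤⟨ ℚ.+-monoˡ-≤ (ι 3) (∣p-q∣≤⇒p≤q+ (ι n * L k) (e + e) (expectedGreedy-close n k 1≤n n+3≤k)) ⟩
  e + e + ι 25 + ι 3           ≡⟨ solve 1 (λ e → e :+ e :+ con (ι 25) :+ con (ι 3) := (e :+ con (ι 14)) :+ (e :+ con (ι 14))) refl e ⟩
  (e + ι 14) + (e + ι 14)      ∎)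
  where
  open ℚ.≤-Reasoning
  h = ℕ.⌈ n /2⌉
  e = expectedGreedy n
  doubled : h ℕ.+ h ≡ n ⊎ h ℕ.+ h ≡ suc n → L k * ι (h ℕ.+ h) ≤ ι n * L k + ι 3
  doubled (inj₁ eq) = begin
    L k * ι (h ℕ.+ h)      ≡⟨ cong (λ m → L k * ι m) eq ⟩
    L k * ι n              ≡⟨ ℚ.*-comm (L k) (ι n) ⟩
    ι n * L k              ≤⟨ p≤p+ε (ι n * L k) (0≤ι 3) ⟩
    ι n * L k + ι 3        ∎
  doubled (inj₂ eq) = begin
    L k * ι (h ℕ.+ h)      ≡⟨ cong (λ m → L k * ι m) eq ⟩
    L k * ι (suc n)        ≡⟨ cong (L k *_) (ι-+ 1 n) ⟩
    L k * (1ℚ + ι n)       ≡⟨ solve 2 (λ l n → l :* (con 1ℚ :+ n) := n :* l :+ l) refl (L k) (ι n) ⟩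
    ι n * L k + L k        ≤⟨ ℚ.+-monoʳ-≤ (ι n * L k) (ℚ.≤-trans (p≤∣p∣ (L k)) (∣L∣≤3 k (ℕ.≤-trans (ℕ.m≤m+n 3 n) n+3≤k))) ⟩
    ι n * L k + ι 3        ∎

-- An even size, whose optimum is exactly `h`. The constant 13 is 25 / 2 rounded up.
expectedGreedy-double≤ : ∀ h k → 1 ℕ.≤ h → 3 ℕ.+ (h ℕ.+ h) ℕ.≤ k →
                         expectedGreedy (h ℕ.+ h) ≤ ι h * L k + ι 13
expectedGreedy-double≤ h k 1≤h n+3≤k = ½-mono (begin
  e + e                                    ≤⟨ ∣p-q∣≤⇒q≤p+ (ι n * L k) (e + e) (expectedGreedy-close n k (ℕ.≤-trans 1≤h (ℕ.m≤m+n h h)) n+3≤k) ⟩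
  ι n * L k + ι 25                         ≤⟨ ℚ.+-monoʳ-≤ (ι n * L k) (ι-mono-≤ {25} {26} (ℕ.n≤1+n 25)) ⟩
  ι n * L k + ι 26                         ≡⟨ cong (λ m → m * L k + ι 26) (ι-+ h h) ⟩
  (ι h + ι h) * L k + ι 26                 ≡⟨ solve 2 (λ h l → (h :+ h) :* l :+ con (ι 26) := (h :* l :+ con (ι 13)) :+ (h :* l :+ con (ι 13))) refl (ι h) (L k) ⟩
  (ι h * L k + ι 13) + (ι h * L k + ι 13)  ∎)
  where
  open ℚ.≤-Reasoning
  n = h ℕ.+ h
  e = expectedGreedy n

-- The competitive ratio

eventually-bounded-above : ∀ x → ∃[ B ] ∃[ N ] (∀ k → N ℕ.≤ k → seq x k ≤ B)
eventually-bounded-above x with isCauchy x 1ℚ (ℚ.positive⁻¹ 1ℚ)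
... | N , close-to-N = seq x N + 1ℚ , N , λ k N≤k →
  ∣p-q∣≤⇒p≤q+ (seq x k) (seq x N) (close-to-N k N N≤k ℕ.≤-refl)

achieves : Achieves (1ᵣ -ᵣ exp (- (+ 2 / 1)))
-- The index from which the comparison holds grows with `n`, whereas the additive constant 14 does
-- not.
achieves = fromℕ 14 , λ n 1≤n C ε 0<ε → 3 ℕ.+ n , λ k n+3≤k → begin
  L k * ι (OPT C) - ι 14                    ≡⟨ cong (λ m → L k * ι m - ι 14) (OPT≡⌈n/2⌉ C) ⟩
  L k * ι ℕ.⌈ n /2⌉ - ι 14                  ≤⟨ ℚ.+-monoˡ-≤ (- ι 14) (L*⌈n/2⌉≤ n k 1≤n n+3≤k) ⟩
  expectedGreedy n + ι 14 - ι 14            ≡⟨ solve 1 (λ e → e :+ con (ι 14) :- con (ι 14) := e) refl (expectedGreedy n) ⟩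
  expectedGreedy n                          ≡⟨ 𝔼-ALG n C ⟨
  𝔼 n (ALG C)                               ≤⟨ p≤p+ε (𝔼 n (ALG C)) (ℚ.<⇒≤ 0<ε) ⟩
  𝔼 n (ALG C) + ε                           ∎
  where open ℚ.≤-Reasoning

-- On a chain of size 2h the guarantee for `ρ` and the upper bound on greedy give, at late indices,
-- ρ h ≤ h L + B + 14, with `B` bounding `b`. Dividing by h gives the claim once ε h exceeds the
-- constant, which is how `h₀` is chosen.
optimal : ∀ ρ → Achieves ρ → ρ ≤ᵣ 1ᵣ -ᵣ exp (- (+ 2 / 1))
optimal ρ (b , ρ-achieved) ε 0<ε = N , bound
  where
  open ℚ.≤-Reasoning
  B  = proj₁ (eventually-bounded-above b)
  N₁ = proj₁ (proj₂ (eventually-bounded-above b))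
  h₀ = proj₁ (archimedean-* ε (B + ι 14) 0<ε)
  -- The successor keeps `h` positive, for the cancellation of `ι h` and for a nonempty chain.
  h  = suc h₀
  n  = h ℕ.+ h
  1≤h : 1 ℕ.≤ h
  1≤h = ℕ.s≤s ℕ.z≤n
  C  = touchingChain n
  -- The tolerance is fixed at 1; added to the 13 of `expectedGreedy-double≤`, it makes up the 14 in
  -- the choice of `h₀`.
  ρ-at-n = ρ-achieved n (ℕ.≤-trans 1≤h (ℕ.m≤m+n h h)) C 1ℚ (ℚ.positive⁻¹ 1ℚ)
  N₂ = proj₁ ρ-at-n
  N  = N₁ ℕ.⊔ N₂ ℕ.⊔ (3 ℕ.+ n)
  OPT≡h : OPT C ≡ h
  OPT≡h = trans (OPT≡⌈n/2⌉ C) (sym (ℕ.n≡⌈n+n/2⌉ h))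
  ε*h≥ : B + ι 14 ≤ ε * ι h
  ε*h≥ = ℚ.≤-trans (proj₂ (archimedean-* ε (B + ι 14) 0<ε))
    (ℚ.*-monoˡ-≤-nonNeg ε {{ℚ.nonNegative (ℚ.<⇒≤ 0<ε)}} (ι-mono-≤ (ℕ.n≤1+n h₀)))
  bound : ∀ k → N ℕ.≤ k → seq ρ k ≤ L k + ε
  bound k N≤k = ℚ.*-cancelˡ-≤-pos (ι h) {{ℚ.normalize-pos h 1}} (begin
    ι h * seq ρ k
      ≡⟨ solve 3 (λ h r b → h :* r := r :* h :- b :+ b) refl (ι h) (seq ρ k) (seq b k) ⟩
    seq ρ k * ι h - seq b k + seq b k
      ≡⟨ cong (λ m → seq ρ k * ι m - seq b k + seq b k) OPT≡h ⟨
    seq ρ k * ι (OPT C) - seq b k + seq b k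
      ≤⟨ ℚ.+-mono-≤ (proj₂ ρ-at-n k (ℕ.m⊔n≤o⇒n≤o N₁ N₂ N₁₂≤k))
                    (proj₂ (proj₂ (eventually-bounded-above b)) k (ℕ.m⊔n≤o⇒m≤o N₁ N₂ N₁₂≤k)) ⟩
    𝔼 n (ALG C) + 1ℚ + B
      ≡⟨ cong (λ e → e + 1ℚ + B) (𝔼-ALG n C) ⟩
    expectedGreedy n + 1ℚ + B
      ≤⟨ ℚ.+-monoˡ-≤ B (ℚ.+-monoˡ-≤ 1ℚ (expectedGreedy-double≤ h k 1≤h (ℕ.m⊔n≤o⇒n≤o (N₁ ℕ.⊔ N₂) (3 ℕ.+ n) N≤k))) ⟩
    ι h * L k + ι 13 + 1ℚ + B
      ≡⟨ solve 2 (λ x b → x :+ con (ι 13) :+ con 1ℚ :+ b := x :+ (b :+ con (ι 14))) refl (ι h * L k) B ⟩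
    ι h * L k + (B + ι 14)
      ≤⟨ ℚ.+-monoʳ-≤ (ι h * L k) ε*h≥ ⟩
    ι h * L k + ε * ι h
      ≡⟨ solve 3 (λ h l ε → h :* l :+ ε :* h := h :* (l :+ ε)) refl (ι h) (L k) ε ⟩
    ι h * (L k + ε) ∎)
    where
    N₁₂≤k : N₁ ℕ.⊔ N₂ ℕ.≤ k
    N₁₂≤k = ℕ.m⊔n≤o⇒m≤o (N₁ ℕ.⊔ N₂) (3 ℕ.+ n) N≤k

theorem1 : IsCompetitiveRatio (1ᵣ -ᵣ exp (- (+ 2 / 1)))
theorem1 = achieves , optimal
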